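{- Let $D$ be any $\bullet/\circ/+$-diagram (with stones colored black iff they are uncrossings). Every sequence of corrective flips starting from $D$ terminates, and it terminates in a Go-diagram.
   Context: Fix $0<k<n$. A Ferrers shape $\lambda$ is the set of unit boxes Northwest of a lattice path from the Northeast to the Southwest corner of a $k$-row, $(n-k)$-column rectangle; path steps labelled $1,\dots,n$ from the Northeast corner. $b^{in}$ is the set of boxes weakly right of and weakly below $b$. A $\bullet/\circ/+$-diagram fills the boxes with black stones, white stones and pluses. Pipe dream: stones become crossing tiles (bottom exits top, right exits left), pluses elbow tiles (bottom exits left, right exits top); the pipe entering at Southeast boundary step $i$ carries label $i$ and flows Northwest. A crossing tile is a crossing if the pipe from below has larger label than the pipe from the right, else an uncrossing. Stones are colored black iff they are uncrossings. $s_i=(i,i+1)$; the top-left box is labelled $s_{n-k}$; the box right of an $s_i$-box is labelled $s_{i-1}$, the box below it $s_{i+1}$; $s_b$ is $b$'s label. A reading order numbers boxes increasing upward and leftward; $u_{b^{in}}$ is the product of $s_c$ over stone boxes $c\in b^{in}$ in increasing reading order; $u_b=s_b$ if $b$ has a stone, else identity. $D$ is a Go-diagram if each box $b$ contains a black stone iff $\ell(u_{b^{in}}u_bs_b)<\ell(u_{b^{in}}u_b)$. A box not containing a black stone but satisfying this inequality violates the distinguished property. Corrective flip: let $b$ contain a plus that violates the distinguished property; the two pipes entering $b$ have previously crossed; let $c$ be the box (a white stone) where they last crossed before reaching $b$, and let the uncrossing partner of $c$, if it exists, be the first box after $c$ (further Northwest) at which these two pipes meet in a crossing tile. A corrective flip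 exchanges the plus in $b$ with the stone in either $c$ or its uncrossing partner, then recolors all stones so that a stone is black iff it is an uncrossing. -}

module Defs where

open import Data.Nat using (ℕ; zero; suc; _+_; _∸_; _≤_; _<_; _<ᵇ_; _≤ᵇ_; _≡ᵇ_; _<?_)
open import Data.Fin using (Fin; toℕ; fromℕ<)
open import Data.Bool using (Bool; true; false; if_then_else_; _∧_)
open import Data.List using (List; []; _∷_; _++_; map; concatMap; filterᵇ; downFrom; upTo; allFin)
open import Data.Nat.ListAction using (sum)
open import Data.Maybe using (Maybe; just; nothing)
open import Data.Product using (Σ; _×_; _,_; proj₁; proj₂)
open import Data.Sum using (_⊎_)
open import Relation.Nullary using (¬_; yes; no)
open import Relation.Binary.PropositionalEquality using (_≡_; _≢_)

-- Ferrers shapes inside a k × m rectangle (m = n - k columns).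
-- The shape λ (set of boxes NW of the lattice path) is recorded by its
-- row lengths: row r (rows 0..k-1 from the top) consists of the boxes in
-- columns 0 .. row r - 1 (columns numbered from the left).  The lattice
-- path is then the boundary of this set of boxes.

record Shape (k m : ℕ) : Set where
  field
    row  : Fin k → ℕ
    row≤ : ∀ i → row i ≤ m
    mono : ∀ (i j : Fin k) → toℕ i ≤ toℕ j → row j ≤ row i

data Tile : Set where
  black white plus : Tile

isStone : Tile → Bool
isStone black = true
isStone white = true
isStone plus  = false

Stone : Tile → Set
Stone t = isStone t ≡ true

-- Permutations of {1..N} given by words in the simple transpositions
-- s_i = (i , i+1).  A word i₁ ∷ i₂ ∷ … denotes the product s_{i₁} s_{i₂} …
-- (composition of functions).  Length = number of inversions.

sᵢ : ℕ → ℕ → ℕ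
sᵢ i x = if x ≡ᵇ i then suc i else (if x ≡ᵇ suc i then i else x)

evalWord : List ℕ → ℕ → ℕ
evalWord []      x = x
evalWord (i ∷ w) x = sᵢ i (evalWord w x)

range1 : ℕ → List ℕ
range1 N = map suc (upTo N)

len : ℕ → List ℕ → ℕ
len N w = sum (map (λ i → sum (map (λ j →
            if (i <ᵇ j) ∧ (evalWord w j <ᵇ evalWord w i) then 1 else 0)
            (range1 N))) (range1 N))

module _ {k m : ℕ} (sh : Shape k m) where
  open Shape sh

  N : ℕ
  N = k + m

  Box : Set
  Box = Σ (Fin k) (λ r → Fin (row r))

  Diagram : Set
  Diagram = Box → Tile

  rowOf colOf : Box → ℕ
  rowOf b = toℕ (proj₁ b)
  colOf b = toℕ (proj₂ b)

  rowℕ : ℕ → ℕ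
  rowℕ r with r <? k
  ... | yes p = row (fromℕ< p)
  ... | no _  = 0

  colℕ : ℕ → ℕ
  colℕ c = sum (map (λ i → if c <ᵇ row i then 1 else 0) (allFin k))

  -- Labels of the steps of the lattice path (numbered 1..n from the NE
  -- corner): label = (# W-steps before) + (# S-steps before) + 1.
  -- vStep r : the vertical (S) step at the right end of row r.
  -- hStep c : the horizontal (W) step at the bottom of column c.
  vStep : ℕ → ℕ
  vStep r = (m ∸ rowℕ r) + r + 1

  hStep : ℕ → ℕ
  hStep c = (m ∸ suc c) + colℕ c + 1

  at : Diagram → ℕ → ℕ → Maybe Tile
  at D r c with r <? k
  ... | no _ = nothing
  ... | yes p with c <? row (fromℕ< p)
  ...   | no _  = nothing
  ...   | yes q = just (D (fromℕ< p , fromℕ< q))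

  boxLabel : ℕ → ℕ → ℕ
  boxLabel r c = (m ∸ c) + r

  sel : Maybe Tile → ℕ → ℕ → ℕ → ℕ
  sel nothing  o s p = o
  sel (just t) o s p = if isStone t then s else p

  -- Pipe dream.  With (r , c) = (k ∸ a , m ∸ b):
  --   H D a b = label of the pipe leaving box (r , c) to the left
  --             (= entering (r , c-1) from the right); if (r , c) is not
  --             a box, it is the pipe entering at the path step there.
  --   V D a b = label of the pipe leaving box (r , c) at the top
  --             (= entering (r-1 , c) from below); likewise at boundary.
  -- Stone: bottom → top, right → left.  Plus: bottom → left, right → top.
  mutual
    H : Diagram → ℕ → ℕ → ℕ
    H D zero    b       = vStep k
    H D (suc a) zero    = vStep (k ∸ suc a)
    H D (suc a) (suc b) =
      sel (at D (k ∸ suc a) (m ∸ suc b)) (vStep (k ∸ suc a))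
          (H D (suc a) b) (V D a (suc b))

    V : Diagram → ℕ → ℕ → ℕ
    V D zero    b       = hStep (m ∸ b)
    V D (suc a) zero    = hStep m
    V D (suc a) (suc b) =
      sel (at D (k ∸ suc a) (m ∸ suc b)) (hStep (m ∸ suc b))
          (V D a (suc b)) (H D (suc a) b)

  fromRight fromBelow : Diagram → Box → ℕ
  fromRight D b = H D (k ∸ rowOf b) (m ∸ suc (colOf b))
  fromBelow D b = V D (k ∸ suc (rowOf b)) (m ∸ colOf b)

  Crossing : Diagram → Box → Set
  Crossing D b = fromRight D b < fromBelow D b

  recolor : Diagram → Diagram
  recolor D b with D b
  ... | plus = plus
  ... | _    = if fromRight D b <ᵇ fromBelow D b then white else black

  WellColored : Diagram → Set
  WellColored D = ∀ b → D b ≡ recolor D b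

  -- Go-diagrams.  Reading order: rows from bottom to top, each row from
  -- right to left (increasing upward and leftward).

  stoneLetter : Maybe Tile → ℕ → List ℕ
  stoneLetter nothing  i = []
  stoneLetter (just t) i = if isStone t then i ∷ [] else []

  -- word of u_{b^in}: stones c in b^in (weakly right of and weakly below
  -- b, b included), in increasing reading order
  wordIn : Diagram → ℕ → ℕ → List ℕ
  wordIn D r c =
    concatMap (λ r' → concatMap (λ c' → stoneLetter (at D r' c') (boxLabel r' c'))
                                (filterᵇ (c ≤ᵇ_) (downFrom (rowℕ r'))))
              (filterᵇ (r ≤ᵇ_) (downFrom k))

  sOf : Box → ℕ
  sOf b = boxLabel (rowOf b) (colOf b)

  uWord : Diagram → Box → List ℕ
  uWord D b = if isStone (D b) then sOf b ∷ [] else []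

  Descent : Diagram → Box → Set
  Descent D b =
    len N ((wordIn D (rowOf b) (colOf b) ++ uWord D b) ++ (sOf b ∷ []))
      < len N (wordIn D (rowOf b) (colOf b) ++ uWord D b)

  IsGo : Diagram → Set
  IsGo D = ∀ b → (D b ≡ black → Descent D b) × (Descent D b → D b ≡ black)

  Violates : Diagram → Box → Set
  Violates D b = D b ≢ black × Descent D b

  -- e comes strictly before d along the (NW-flowing) pipes: e is weakly
  -- below and weakly right of d, and e ≠ d.
  Before : Box → Box → Set
  Before e d = rowOf d ≤ rowOf e × colOf d ≤ colOf e
             × (rowOf d < rowOf e ⊎ colOf d < colOf e)

  Meet : Diagram → ℕ → ℕ → Box → Set
  Meet D x y d = (fromBelow D d ≡ x × fromRight D d ≡ y)
               ⊎ (fromBelow D d ≡ y × fromRight D d ≡ x)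

  LastCrossing : Diagram → Box → Box → Set
  LastCrossing D b c =
    Stone (D c) × Meet D x y c × Crossing D c × Before c b ×
    (∀ d → Stone (D d) → Meet D x y d → Crossing D d → Before c d → ¬ Before d b)
    where
      x = fromBelow D b
      y = fromRight D b

  UncrossingPartner : Diagram → Box → Box → Box → Set
  UncrossingPartner D b c e =
    Stone (D e) × Meet D x y e × Before c e ×
    (∀ d → Stone (D d) → Meet D x y d → Before c d → ¬ Before d e)
    where
      x = fromBelow D b
      y = fromRight D b

  sameBox : Box → Box → Bool
  sameBox d e = (rowOf d ≡ᵇ rowOf e) ∧ (colOf d ≡ᵇ colOf e)

  -- put a stone in b and a plus in e (stone colour is recomputed later)
  exchange : Diagram → Box → Box → Diagram
  exchange D b e d = if sameBox d b then white else (if sameBox d e then plus else D d)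

  Flip : Diagram → Diagram → Set
  Flip D D' =
    Σ Box λ b → D b ≡ plus × Violates D b ×
    Σ Box λ c → LastCrossing D b c ×
    Σ Box λ e → (e ≡ c ⊎ UncrossingPartner D b c e) ×
    (∀ d → D' d ≡ recolor (exchange D b e) d)

  Terminal : Diagram → Set
  Terminal D = ∀ D' → ¬ Flip D D'

-- Read the boxes in reading order and follow the permutation sending a position on the
-- frontier to the label of the pipe standing there; a stone multiplies it by the letter
-- of its box, a plus leaves it unchanged. The pipes entering b sit at the positions
-- moved by s_b, so b is a descent iff they are inverted.
--
-- A corrective flip for pipes x < y exchanges two tiles at which x and y are adjacent.
-- Between these two moments the permutation is multiplied by the transposition (x y),
-- and everywhere else it is unchanged. As x and y are inverted throughout that interval,
-- the transposition sorts them and, by the rearrangement inequality, the sum over all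
-- moments t and positions p of (n ∸ p) * (label at p) strictly drops.
--
-- Conversely, if a plus violates the distinguished property, its two pipes are inverted,
-- hence have crossed, and exchanging with the last crossing is a legal flip.
module Submission where

open import Defs
open import Data.Bool using (Bool; true; false; not; if_then_else_; _∧_)
open import Data.Bool.Properties using (T-≡; ∧-identityʳ; ∧-zeroʳ)
open import Data.Empty using (⊥-elim)
open import Data.Fin using (Fin; toℕ; fromℕ<; zero; suc)
open import Data.Fin.Properties using (toℕ<n; toℕ-fromℕ<; fromℕ<-toℕ)
open import Data.List using (List; []; _∷_; _++_; map; concatMap; filterᵇ; downFrom; upTo; tabulate)
open import Data.List.Properties using (map-++; upTo-∷ʳ; concatMap-cong; map-tabulate)
open import Data.Maybe using (Maybe; just; nothing)
open import Data.Nat using (ℕ; zero; suc; _+_; _*_; _∸_; _≤_; _<_; z≤n; s≤s; _≡ᵇ_; _≤ᵇ_; _<ᵇ_; _≟_; _<?_; _≤?_; NonZero; _/_; _%_; >-nonZero)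
open import Data.Nat.DivMod using (+-distrib-/-∣ʳ; m<n⇒m/n≡0; m*n/n≡m; [m+kn]%n≡m%n; m<n⇒m%n≡m; m≡m%n+[m/n]*n; m%n<n; m<n*o⇒m/o<n)
open import Data.Nat.Divisibility using (n∣m*n)
open import Data.Nat.Induction using (<-wellFounded)
open import Data.Nat.ListAction using (sum)
open import Data.Nat.ListAction.Properties using (sum-++)
open import Data.Nat.Properties
open import Data.Nat.Tactic.RingSolver using (solve)
open import Data.Product using (∃; _×_; _,_; proj₁; proj₂)
open import Data.Sum using (_⊎_; inj₁; inj₂)
import Data.Sum as Sum
open import Function using (_∘_; _on_)
open import Function.Bundles using (Equivalence)
open import Function.Definitions using (Injective)
open import Induction.WellFounded using (Acc; module Subrelation)
open import Relation.Binary using (tri<; tri≈; tri>)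
open import Relation.Binary.Construct.Closure.ReflexiveTransitive using (Star; ε; _◅_)
import Relation.Binary.Construct.On as On
open import Relation.Binary.PropositionalEquality
open import Relation.Nullary using (¬_; yes; no)

-- Simple transpositions

≡ᵇ-refl : ∀ n → (n ≡ᵇ n) ≡ true
≡ᵇ-refl zero    = refl
≡ᵇ-refl (suc n) = ≡ᵇ-refl n

≢⇒≡ᵇ-false : ∀ m n → m ≢ n → (m ≡ᵇ n) ≡ false
≢⇒≡ᵇ-false zero    zero    m≢n = ⊥-elim (m≢n refl)
≢⇒≡ᵇ-false zero    (suc n) m≢n = refl
≢⇒≡ᵇ-false (suc m) zero    m≢n = refl
≢⇒≡ᵇ-false (suc m) (suc n) m≢n = ≢⇒≡ᵇ-false m n (m≢n ∘ cong suc)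

sᵢ-left : ∀ i → sᵢ i i ≡ suc i
sᵢ-left i rewrite ≡ᵇ-refl i = refl

sᵢ-right : ∀ i → sᵢ i (suc i) ≡ i
sᵢ-right i rewrite ≢⇒≡ᵇ-false (suc i) i 1+n≢n | ≡ᵇ-refl i = refl

sᵢ-fix : ∀ i {p} → p ≢ i → p ≢ suc i → sᵢ i p ≡ p
sᵢ-fix i {p} p≢i p≢1+i
  rewrite ≢⇒≡ᵇ-false p i p≢i | ≢⇒≡ᵇ-false p (suc i) p≢1+i = refl

data Position (i : ℕ) : ℕ → Set where
  left  : Position i i
  right : Position i (suc i)
  away  : ∀ {p} → p ≢ i → p ≢ suc i → Position i p

position : ∀ i p → Position i p
position i p with p ≟ i
... | yes refl = left
... | no p≢i with p ≟ suc i
...   | yes refl  = right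
...   | no p≢1+i = away p≢i p≢1+i

sᵢ-involutive : ∀ i p → sᵢ i (sᵢ i p) ≡ p
sᵢ-involutive i p with position i p
... | left  rewrite sᵢ-left i  = sᵢ-right i
... | right rewrite sᵢ-right i = sᵢ-left i
... | away p≢i p≢1+i rewrite sᵢ-fix i p≢i p≢1+i = sᵢ-fix i p≢i p≢1+i

sᵢ-injective : ∀ i → Injective _≡_ _≡_ (sᵢ i)
sᵢ-injective i {p} {q} eq =
  trans (sym (sᵢ-involutive i p)) (trans (cong (sᵢ i) eq) (sᵢ-involutive i q))

sᵢ-< : ∀ {i n p} → suc i < n → p < n → sᵢ i p < n
sᵢ-< {i} {n} {p} i<n p<n with position i p
... | left  rewrite sᵢ-left i  = i<n
... | right rewrite sᵢ-right i = <-trans (n<1+n i) i<n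
... | away p≢i p≢1+i rewrite sᵢ-fix i p≢i p≢1+i = p<n

-- Only i moves up and only i + 1 moves down, each by one, so the excluded pair is the only one
-- whose order can be upset.
sᵢ-mono-< : ∀ i {p q} → p < q → ¬ (p ≡ i × q ≡ suc i) → sᵢ i p < sᵢ i q
sᵢ-mono-< i {p} {q} p<q ≢pair with position i p | position i q
... | left  | left  = ⊥-elim (<-irrefl refl p<q)
... | left  | right = ⊥-elim (≢pair (refl , refl))
... | left  | away a b rewrite sᵢ-left i | sᵢ-fix i a b = ≤∧≢⇒< p<q (b ∘ sym)
... | right | left  = ⊥-elim (<-asym p<q (n<1+n i))
... | right | right = ⊥-elim (<-irrefl refl p<q)
... | right | away a b rewrite sᵢ-right i | sᵢ-fix i a b = <-trans (n<1+n i) p<q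
... | away a b | left  rewrite sᵢ-left i | sᵢ-fix i a b = <-trans p<q (n<1+n i)
... | away a b | right rewrite sᵢ-right i | sᵢ-fix i a b = ≤∧≢⇒< (≤-pred p<q) a
... | away a b | away c d rewrite sᵢ-fix i a b | sᵢ-fix i c d = p<q

step : Bool → ℕ → ℕ → ℕ
step β i p = if β then sᵢ i p else p

step-injective : ∀ β i → Injective _≡_ _≡_ (step β i)
step-injective true  i eq = sᵢ-injective i eq
step-injective false i eq = eq

step-fix : ∀ β i {p} → p ≢ i → p ≢ suc i → step β i p ≡ p
step-fix true  i p≢i p≢1+i = sᵢ-fix i p≢i p≢1+i
step-fix false i p≢i p≢1+i = refl

step-involutive : ∀ β i p → step β i (step β i p) ≡ p
step-involutive true  i p = sᵢ-involutive i p
step-involutive false i p = refl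

-- Finite sums

Σ< : ℕ → (ℕ → ℕ) → ℕ
Σ< zero    f = 0
Σ< (suc n) f = Σ< n f + f n

Σ<-cong : ∀ n {f g} → (∀ p → p < n → f p ≡ g p) → Σ< n f ≡ Σ< n g
Σ<-cong zero    eq = refl
Σ<-cong (suc n) eq = cong₂ _+_ (Σ<-cong n (λ p p<n → eq p (m<n⇒m<1+n p<n))) (eq n (n<1+n n))

Σ<-mono-≤ : ∀ n {f g} → (∀ p → p < n → f p ≤ g p) → Σ< n f ≤ Σ< n g
Σ<-mono-≤ zero    le = z≤n
Σ<-mono-≤ (suc n) le = +-mono-≤ (Σ<-mono-≤ n (λ p p<n → le p (m<n⇒m<1+n p<n))) (le n (n<1+n n))

Σ<-mono-< : ∀ n {f g} → (∀ p → p < n → f p ≤ g p) → ∀ {q} → q < n → f q < g q → Σ< n f < Σ< n g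
Σ<-mono-< (suc n) le {q} q<1+n lt with q ≟ n
... | yes refl = +-mono-≤-< (Σ<-mono-≤ n (λ p p<n → le p (m<n⇒m<1+n p<n))) lt
... | no q≢n   = +-mono-<-≤
  (Σ<-mono-< n (λ p p<n → le p (m<n⇒m<1+n p<n)) (≤∧≢⇒< (≤-pred q<1+n) q≢n) lt) (le n (n<1+n n))

+-swapʳ : ∀ x y z → x + y + z ≡ x + z + y
+-swapʳ x y z = solve (x ∷ y ∷ z ∷ [])

-- The value at p is added on both sides because subtraction of natural numbers is truncated.
Σ<-exchange₁ : ∀ n {f g p} → p < n → (∀ r → r ≢ p → f r ≡ g r) → Σ< n f + g p ≡ Σ< n g + f p
Σ<-exchange₁ (suc n) {f} {g} {p} p<1+n eq with p ≟ n
... | yes refl = begin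
  Σ< n f + f n + g n ≡⟨ cong (λ z → z + f n + g n) (Σ<-cong n (λ r r<n → eq r (<⇒≢ r<n))) ⟩
  Σ< n g + f n + g n ≡⟨ +-swapʳ (Σ< n g) (f n) (g n) ⟩
  Σ< n g + g n + f n ∎
  where
  open ≡-Reasoning
... | no p≢n = begin
  Σ< n f + f n + g p ≡⟨ +-swapʳ (Σ< n f) (f n) (g p) ⟩
  Σ< n f + g p + f n ≡⟨ cong₂ _+_ (Σ<-exchange₁ n (≤∧≢⇒< (≤-pred p<1+n) p≢n) eq) (eq n (p≢n ∘ sym)) ⟩
  Σ< n g + f p + g n ≡⟨ +-swapʳ (Σ< n g) (f p) (g n) ⟩
  Σ< n g + g n + f p ∎
  where
  open ≡-Reasoning

Σ<-exchange₂ : ∀ n {f g p q} → p < n → q < n → p ≢ q →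
  (∀ r → r ≢ p → r ≢ q → f r ≡ g r) → Σ< n f + (g p + g q) ≡ Σ< n g + (f p + f q)
Σ<-exchange₂ n {f} {g} {p} {q} p<n q<n p≢q eq = +-cancelʳ-≡ (Σ< n h) _ _ (begin
  Σ< n f + (g p + g q) + Σ< n h       ≡⟨ rearrange (Σ< n f) (g p) (g q) (Σ< n h) ⟩
  (Σ< n f + g p) + (Σ< n h + g q)     ≡⟨ cong (λ z → (Σ< n f + z) + (Σ< n h + g q)) (sym h-at) ⟩
  (Σ< n f + h p) + (Σ< n h + g q)     ≡⟨ cong₂ _+_ (Σ<-exchange₁ n p<n (λ r r≢p → sym (h-off r≢p))) (Σ<-exchange₁ n q<n h≡g) ⟩
  (Σ< n h + f p) + (Σ< n g + h q)     ≡⟨ cong (λ z → (Σ< n h + f p) + (Σ< n g + z)) (h-off (p≢q ∘ sym)) ⟩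
  (Σ< n h + f p) + (Σ< n g + f q)     ≡⟨ rearrange′ (Σ< n h) (f p) (Σ< n g) (f q) ⟩
  Σ< n g + (f p + f q) + Σ< n h       ∎)
  where
  open ≡-Reasoning
  -- `h` follows `g` at p and `f` elsewhere, so it differs from each of them in one place only.
  h : ℕ → ℕ
  h r = if r ≡ᵇ p then g p else f r
  h-at : h p ≡ g p
  h-at rewrite ≡ᵇ-refl p = refl
  h-off : ∀ {r} → r ≢ p → h r ≡ f r
  h-off {r} r≢p rewrite ≢⇒≡ᵇ-false r p r≢p = refl
  h≡g : ∀ r → r ≢ q → h r ≡ g r
  h≡g r r≢q with r ≟ p
  ... | yes refl = h-at
  ... | no r≢p   = trans (h-off r≢p) (eq r r≢p r≢q)
  rearrange : ∀ a b c d → a + (b + c) + d ≡ (a + b) + (d + c)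
  rearrange a b c d = solve (a ∷ b ∷ c ∷ d ∷ [])
  rearrange′ : ∀ a b c d → (a + b) + (c + d) ≡ c + (b + d) + a
  rearrange′ a b c d = solve (a ∷ b ∷ c ∷ d ∷ [])

-- Exchanging two values

exch : ℕ → ℕ → ℕ → ℕ
exch x y z with z ≟ x | z ≟ y
... | yes _ | _     = y
... | no _  | yes _ = x
... | no _  | no _  = z

exch-left : ∀ x y → exch x y x ≡ y
exch-left x y with x ≟ x | x ≟ y
... | yes _  | _ = refl
... | no x≢x | _ = ⊥-elim (x≢x refl)

exch-right : ∀ x y → exch x y y ≡ x
exch-right x y with y ≟ x | y ≟ y
... | yes eq | _      = eq
... | no _   | yes _  = refl
... | no _   | no y≢y = ⊥-elim (y≢y refl)

exch-fix : ∀ x y {z} → z ≢ x → z ≢ y → exch x y z ≡ z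
exch-fix x y {z} z≢x z≢y with z ≟ x | z ≟ y
... | yes eq | _      = ⊥-elim (z≢x eq)
... | no _   | yes eq = ⊥-elim (z≢y eq)
... | no _   | no _   = refl

exch-involutive : ∀ x y z → exch x y (exch x y z) ≡ z
exch-involutive x y z with z ≟ x | z ≟ y
... | yes refl | _        = exch-right z y
... | no _     | yes refl = exch-left x z
... | no z≢x   | no z≢y   = exch-fix x y z≢x z≢y

-- Adjacent and inverted labels

Adjacent : (ℕ → ℕ) → ℕ → ℕ → ℕ → Set
Adjacent f i x y = (f i ≡ x × f (suc i) ≡ y) ⊎ (f i ≡ y × f (suc i) ≡ x)

-- Multiplying by s_i on the right moves positions, multiplying by (x y) on the left moves labels.
-- The two agree when x and y stand at i and i + 1; injectivity keeps x and y away from all other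
-- positions.
exch-sᵢ : ∀ {f i x y} → Injective _≡_ _≡_ f → Adjacent f i x y → ∀ p → f (sᵢ i p) ≡ exch x y (f p)
exch-sᵢ {f} {i} inj (inj₁ (refl , refl)) p with position i p
... | left  = trans (cong f (sᵢ-left i)) (sym (exch-left (f i) (f (suc i))))
... | right = trans (cong f (sᵢ-right i)) (sym (exch-right (f i) (f (suc i))))
... | away a b = trans (cong f (sᵢ-fix i a b)) (sym (exch-fix _ _ (a ∘ inj) (b ∘ inj)))
exch-sᵢ {f} {i} inj (inj₂ (refl , refl)) p with position i p
... | left  = trans (cong f (sᵢ-left i)) (sym (exch-right (f (suc i)) (f i)))
... | right = trans (cong f (sᵢ-right i)) (sym (exch-left (f (suc i)) (f i)))
... | away a b = trans (cong f (sᵢ-fix i a b)) (sym (exch-fix _ _ (b ∘ inj) (a ∘ inj)))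

-- Toggling a tile at which x and y are adjacent amounts to the transposition (x y) of labels,
-- whichever tile was there before.
exch-step : ∀ {f i x y} β → Injective _≡_ _≡_ f → Adjacent f i x y →
  ∀ p → f (step (not β) i p) ≡ exch x y (f (step β i p))
exch-step {f} {i} true  inj adj p =
  trans (cong f (sym (sᵢ-involutive i p))) (exch-sᵢ inj adj (sᵢ i p))
exch-step false inj adj p = exch-sᵢ inj adj p

-- Meant for x < y: the larger label comes first.
Inverted : ℕ → (ℕ → ℕ) → ℕ → ℕ → Set
Inverted n f x y = ∃ λ p → ∃ λ q → p < q × q < n × f p ≡ y × f q ≡ x

-- The labels travel with their positions, whose order survives unless they are the two neighbours
-- being exchanged.
inverted-sᵢ : ∀ {n f i x y} → suc i < n → Inverted n f x y →
  ¬ (f i ≡ y × f (suc i) ≡ x) → Inverted n (f ∘ sᵢ i) x y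
inverted-sᵢ {f = f} {i} i<n (p , q , p<q , q<n , fp , fq) ≢pair =
  sᵢ i p , sᵢ i q , sᵢ-mono-< i p<q (λ { (refl , refl) → ≢pair (fp , fq) }) , sᵢ-< i<n q<n ,
  trans (cong f (sᵢ-involutive i p)) fp , trans (cong f (sᵢ-involutive i q)) fq

inverted-cong : ∀ {n f g x y} → (∀ p → f p ≡ g p) → Inverted n f x y → Inverted n g x y
inverted-cong eq (p , q , p<q , q<n , fp , fq) =
  p , q , p<q , q<n , trans (sym (eq p)) fp , trans (sym (eq q)) fq

¬inverted : ∀ {n f i x y} → Injective _≡_ _≡_ f → f i ≡ x → f (suc i) ≡ y → ¬ Inverted n f x y
¬inverted {i = i} inj fi fi′ (p , q , p<q , q<n , fp , fq)
  rewrite inj (trans fp (sym fi′)) | inj (trans fq (sym fi)) = <-asym p<q (n<1+n i)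

-- Weighted sums of labels and the rearrangement inequality

weight : ℕ → (ℕ → ℕ) → ℕ
weight n f = Σ< n (λ p → (n ∸ p) * f p)

rearrangement : ∀ {u w x y} → u < w → x < y → w * x + u * y < w * y + u * x
rearrangement {u} {_} {x} u<w x<y
  with d , refl ← m≤n⇒∃[o]m+o≡n u<w | e , refl ← m≤n⇒∃[o]m+o≡n x<y =
  subst (suc (suc (u + d) * x + u * suc (x + e)) ≤_) (sym (expand u d x e))
    (s≤s (m≤m+n (suc (u + d) * x + u * suc (x + e)) (d + e + d * e)))
  where
  -- With w = u + d + 1 and y = x + e + 1 the two sides differ by (w - u)(y - x) = (d + 1)(e + 1),
  -- written as 1 + (d + e + d * e).
  expand : ∀ u d x e → suc (u + d) * suc (x + e) + u * x
         ≡ suc ((suc (u + d) * x + u * suc (x + e)) + (d + e + d * e))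
  expand u d x e = solve (u ∷ d ∷ x ∷ e ∷ [])

-- Of the two positions, p has the larger factor `n ∸ p` and, by inversion, the larger label. The
-- exchange gives it the smaller label and leaves all other terms alone.
weight-exch : ∀ {n f x y} → x < y → Injective _≡_ _≡_ f → Inverted n f x y →
  weight n (exch x y ∘ f) < weight n f
weight-exch {n} {f} {x} {y} x<y inj (p , q , p<q , q<n , refl , refl) =
  +-cancelʳ-< (F p + F q) _ _ (subst (_< Σ< n F + (F p + F q)) (sym total)
    (+-monoʳ-< (Σ< n F) smaller))
  where
  F G : ℕ → ℕ
  F r = (n ∸ r) * f r
  G r = (n ∸ r) * exch x y (f r)
  total : Σ< n G + (F p + F q) ≡ Σ< n F + (G p + G q)
  total = Σ<-exchange₂ n (<-trans p<q q<n) q<n (<⇒≢ p<q)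
    (λ r r≢p r≢q → cong ((n ∸ r) *_) (exch-fix x y (r≢q ∘ inj) (r≢p ∘ inj)))
  smaller : G p + G q < F p + F q
  smaller rewrite exch-right x y | exch-left x y =
    rearrangement (∸-monoʳ-< p<q (<⇒≤ q<n)) x<y

-- States of the frontier along a sequence of letters

module Sorting (letter : ℕ → ℕ) where

  -- The newest letter acts first on the position, so the product grows on the right and the values
  -- remain pipe labels.
  state : (ℕ → Bool) → ℕ → ℕ → ℕ
  state τ zero    p = p
  state τ (suc t) p = state τ t (step (τ t) (letter t) p)

  state-injective : ∀ τ t → Injective _≡_ _≡_ (state τ t)
  state-injective τ zero    eq = eq
  state-injective τ (suc t) eq = step-injective (τ t) (letter t) (state-injective τ t eq)

  -- Position `letter t` holds the pipe from the right, its successor the pipe from below. For x <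
  -- y, `Crosses τ x y` is therefore a crossing and `Crosses τ y x` an uncrossing.
  Crosses : (ℕ → Bool) → ℕ → ℕ → ℕ → Set
  Crosses τ x y t = τ t ≡ true × state τ t (letter t) ≡ x × state τ t (suc (letter t)) ≡ y

  module _ {n M : ℕ} (letter< : ∀ {t} → t < M → suc (letter t) < n) where

    inverted-suc : ∀ τ {x y t} → t < M → Inverted n (state τ t) x y →
      ¬ Crosses τ y x t → Inverted n (state τ (suc t)) x y
    inverted-suc τ {t = t} t<M inv ¬c with τ t in eq
    ... | true  = inverted-sᵢ (letter< t<M) inv (λ (fi , fi′) → ¬c (refl , fi , fi′))
    ... | false = inv

    -- Read backwards, a stone acts by the same involution; an inversion that is absent before it
    -- was created there, by a crossing of the two pipes.
    inverted-pred : ∀ τ {x y t} → t < M → Inverted n (state τ (suc t)) x y →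
      ¬ Crosses τ x y t → Inverted n (state τ t) x y
    inverted-pred τ {t = t} t<M inv ¬c with τ t in eq
    ... | true  = inverted-cong (λ p → cong (state τ t) (sᵢ-involutive (letter t) p))
      (inverted-sᵢ (letter< t<M) inv λ (fi , fi′) →
        ¬c (refl , trans (cong (state τ t) (sym (sᵢ-right _))) fi′ ,
                   trans (cong (state τ t) (sym (sᵢ-left _))) fi))
    ... | false = inv

    inverted-forward : ∀ τ {x y t₁ t₂} → t₁ ≤ t₂ → t₂ ≤ M → Inverted n (state τ t₁) x y →
      (∀ t → t₁ ≤ t → t < t₂ → ¬ Crosses τ y x t) → Inverted n (state τ t₂) x y
    inverted-forward τ {t₁ = t₁} {t₂} t₁≤t₂ t₂≤M inv ¬c with t₁ ≟ t₂
    inverted-forward τ t₁≤t₂ t₂≤M inv ¬c | yes refl = inv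
    inverted-forward τ {t₂ = zero} z≤n t₂≤M inv ¬c | no t₁≢t₂ = ⊥-elim (t₁≢t₂ refl)
    inverted-forward τ {t₁ = t₁} {suc t₂} t₁≤1+t₂ t₂<M inv ¬c | no t₁≢t₂ =
      inverted-suc τ t₂<M
        (inverted-forward τ t₁≤t₂ (<⇒≤ t₂<M) inv (λ t le lt → ¬c t le (m<n⇒m<1+n lt)))
        (¬c t₂ t₁≤t₂ (n<1+n t₂))
      where t₁≤t₂ = ≤-pred (≤∧≢⇒< t₁≤1+t₂ t₁≢t₂)

    inverted-backward : ∀ τ {x y t₁ t₂} → t₁ ≤ t₂ → t₂ ≤ M → Inverted n (state τ t₂) x y →
      (∀ t → t₁ ≤ t → t < t₂ → ¬ Crosses τ x y t) → Inverted n (state τ t₁) x y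
    inverted-backward τ {t₁ = t₁} {t₂} t₁≤t₂ t₂≤M inv ¬c with t₁ ≟ t₂
    inverted-backward τ t₁≤t₂ t₂≤M inv ¬c | yes refl = inv
    inverted-backward τ {t₂ = zero} z≤n t₂≤M inv ¬c | no t₁≢t₂ = ⊥-elim (t₁≢t₂ refl)
    inverted-backward τ {t₁ = t₁} {suc t₂} t₁≤1+t₂ t₂<M inv ¬c | no t₁≢t₂ =
      inverted-backward τ t₁≤t₂ (<⇒≤ t₂<M)
        (inverted-pred τ t₂<M inv (¬c t₂ t₁≤t₂ (n<1+n t₂)))
        (λ t le lt → ¬c t le (m<n⇒m<1+n lt))
      where t₁≤t₂ = ≤-pred (≤∧≢⇒< t₁≤1+t₂ t₁≢t₂)

    crosses? : ∀ τ x y t → Crosses τ x y t ⊎ ¬ Crosses τ x y t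
    crosses? τ x y t with τ t | state τ t (letter t) ≟ x | state τ t (suc (letter t)) ≟ y
    ... | false | _      | _      = inj₂ λ ()
    ... | true  | no ≢x  | _      = inj₂ (≢x ∘ proj₁ ∘ proj₂)
    ... | true  | yes _  | no ≢y  = inj₂ (≢y ∘ proj₂ ∘ proj₂)
    ... | true  | yes ≡x | yes ≡y = inj₁ (refl , ≡x , ≡y)

    last-crossing : ∀ τ {x y} → x < y → ∀ t → t ≤ M → Inverted n (state τ t) x y →
      ∃ λ s → s < t × Crosses τ x y s × (∀ r → s < r → r < t → ¬ Crosses τ x y r)
    -- The initial state is the identity, which inverts no labels x < y.
    last-crossing τ x<y zero t≤M (p , q , p<q , q<n , refl , refl) = ⊥-elim (<-asym x<y p<q)
    last-crossing τ {x} {y} x<y (suc t) t<M inv with crosses? τ x y t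
    ... | inj₁ c = t , n<1+n t , c , λ r t<r r<1+t → ⊥-elim (<⇒≱ t<r (≤-pred r<1+t))
    ... | inj₂ ¬c with last-crossing τ x<y t (<⇒≤ t<M) (inverted-pred τ t<M inv ¬c)
    ...   | s , s<t , c , last = s , m<n⇒m<1+n s<t , c , last′
      where
      last′ : ∀ r → s < r → r < suc t → ¬ Crosses τ x y r
      last′ r s<r r<1+t with r ≟ t
      ... | yes refl = ¬c
      ... | no r≢t   = last r s<r (≤∧≢⇒< (≤-pred r<1+t) r≢t)

  -- The potential under the toggling of two tiles

  potential : ℕ → ℕ → (ℕ → Bool) → ℕ
  potential n M τ = Σ< M (λ t → weight n (state τ t))

  module _ {τ τ′ : ℕ → Bool} {x y t₁ t₂ M : ℕ} (t₁<t₂ : t₁ < t₂) (t₂<M : t₂ < M)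
    (same : ∀ t → t < M → t ≢ t₁ → t ≢ t₂ → τ′ t ≡ τ t)
    (diff₁ : τ′ t₁ ≡ not (τ t₁)) (diff₂ : τ′ t₂ ≡ not (τ t₂))
    (adj₁ : Adjacent (state τ t₁) (letter t₁) x y)
    (adj₂ : Adjacent (state τ t₂) (letter t₂) x y) where

    private
      step-same : ∀ {t} (φ : ℕ → ℕ) → τ′ t ≡ τ t →
        (∀ p → state τ′ t p ≡ φ (state τ t p)) → ∀ p → state τ′ (suc t) p ≡ φ (state τ (suc t) p)
      step-same φ τ≡ eq p rewrite τ≡ = eq _

      -- `φ` is the change accumulated so far. The new transposition acts inside it, on labels of
      -- `τ`, so adjacency is only asked for in the original sequence.
      step-diff : ∀ {t} (φ : ℕ → ℕ) → τ′ t ≡ not (τ t) → Adjacent (state τ t) (letter t) x y →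
        (∀ p → state τ′ t p ≡ φ (state τ t p)) →
        ∀ p → state τ′ (suc t) p ≡ φ (exch x y (state τ (suc t) p))
      step-diff {t} φ τ≢ adj eq p rewrite τ≢ =
        trans (eq _) (cong φ (exch-step (τ t) (state-injective τ t) adj p))

    state-before : ∀ t → t ≤ t₁ → ∀ p → state τ′ t p ≡ state τ t p
    state-before zero    _    p = refl
    state-before (suc t) t<t₁ = step-same (λ z → z)
      (same t (<-trans t<t₂ t₂<M) (<⇒≢ t<t₁) (<⇒≢ t<t₂)) (state-before t (<⇒≤ t<t₁))
      where t<t₂ = <-trans t<t₁ t₁<t₂

    state-between : ∀ t → t₁ < t → t ≤ t₂ → ∀ p → state τ′ t p ≡ exch x y (state τ t p)
    state-between (suc t) t₁<1+t t<t₂ with t ≟ t₁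
    ... | yes refl = step-diff (λ z → z) diff₁ adj₁ (state-before t ≤-refl)
    ... | no t≢t₁  = step-same (exch x y) (same t (<-trans t<t₂ t₂<M) t≢t₁ (<⇒≢ t<t₂))
      (state-between t (≤∧≢⇒< (≤-pred t₁<1+t) (t≢t₁ ∘ sym)) (<⇒≤ t<t₂))

    state-after : ∀ t → t₂ < t → t ≤ M → ∀ p → state τ′ t p ≡ state τ t p
    state-after (suc t) t₂<1+t t<M with t ≟ t₂
    -- The second toggle contributes (x y) once more and cancels the first.
    ... | yes refl = λ p → trans
      (step-diff (exch x y) diff₂ adj₂ (state-between t t₁<t₂ ≤-refl) p) (exch-involutive x y _)
    ... | no t≢t₂  = step-same (λ z → z) (same t t<M (>⇒≢ (<-trans t₁<t₂ t₂<t)) t≢t₂)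
      (state-after t t₂<t (<⇒≤ t<M))
      where t₂<t = ≤∧≢⇒< (≤-pred t₂<1+t) (t≢t₂ ∘ sym)

    potential-decreases : ∀ {n} → x < y →
      (∀ t → t₁ < t → t ≤ t₂ → Inverted n (state τ t) x y) →
      potential n M τ′ < potential n M τ
    -- Strictness is taken at the moment `t₂`: its own tile is still unread, so the state is one of
    -- those already sorted by (x y).
    potential-decreases {n} x<y inv = Σ<-mono-< M pointwise t₂<M (between t₁<t₂ ≤-refl)
      where
      weight-cong : ∀ {f g : ℕ → ℕ} → (∀ p → f p ≡ g p) → weight n f ≡ weight n g
      weight-cong eq = Σ<-cong n (λ p _ → cong ((n ∸ p) *_) (eq p))
      between : ∀ {t} → t₁ < t → t ≤ t₂ → weight n (state τ′ t) < weight n (state τ t)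
      between {t} t₁<t t≤t₂ = subst (_< weight n (state τ t))
        (sym (weight-cong (state-between t t₁<t t≤t₂)))
        (weight-exch x<y (state-injective τ t) (inv t t₁<t t≤t₂))
      pointwise : ∀ t → t < M → weight n (state τ′ t) ≤ weight n (state τ t)
      pointwise t t<M with t ≤? t₁ | t ≤? t₂
      ... | yes t≤t₁ | _        = ≤-reflexive (weight-cong (state-before t t≤t₁))
      ... | no t≰t₁  | yes t≤t₂ = <⇒≤ (between (≰⇒> t≰t₁) t≤t₂)
      ... | no _     | no t≰t₂  = ≤-reflexive (weight-cong (state-after t (≰⇒> t≰t₂) (<⇒≤ t<M)))

∸-suc-< : ∀ {n i} → i < n → n ∸ i ≡ suc (n ∸ suc i)
∸-suc-< i<n = +-∸-assoc 1 i<n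

-- Pipe dreams on the full rectangle

module Grid (k m : ℕ) .{{_ : NonZero m}} where

  Cells : Set
  Cells = ℕ → ℕ → Bool

  -- Quotient and remainder of the moment are the row from the bottom and the column from the right;
  -- the value is the index of the simple transposition labelling that box.
  letter : ℕ → ℕ
  letter t = (k ∸ t / m) + t % m

  open Sorting letter public

  signal : Cells → ℕ → Bool
  signal T t = T (t / m) (t % m)

  -- The column m is allowed: `time a m` computes to `time (suc a) 0`, so the end of a row and the
  -- start of the next are one moment.
  time : ℕ → ℕ → ℕ
  time a b = b + a * m

  time-/ : ∀ a {b} → b < m → time a b / m ≡ a
  time-/ a {b} b<m = trans (+-distrib-/-∣ʳ b (n∣m*n a))
    (cong₂ _+_ (m<n⇒m/n≡0 b<m) (m*n/n≡m a m))

  time-% : ∀ a {b} → b < m → time a b % m ≡ b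
  time-% a {b} b<m = trans ([m+kn]%n≡m%n b a m) (m<n⇒m%n≡m b<m)

  time-letter : ∀ a {b} → b < m → letter (time a b) ≡ (k ∸ a) + b
  time-letter a b<m = cong₂ (λ i j → (k ∸ i) + j) (time-/ a b<m) (time-% a b<m)

  time-signal : ∀ T a {b} → b < m → signal T (time a b) ≡ T a b
  time-signal T a b<m = cong₂ T (time-/ a b<m) (time-% a b<m)

  time-inverse : ∀ t → time (t / m) (t % m) ≡ t
  time-inverse t = sym (m≡m%n+[m/n]*n t m)

  time< : ∀ {a b} → a < k → b < m → time a b < k * m
  time< {a} a<k b<m = <-≤-trans (+-monoˡ-< (a * m) b<m) (*-monoˡ-≤ m a<k)

  row< : ∀ {t} → t < k * m → t / m < k
  row< = m<n*o⇒m/o<n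

  -- Pipe labels start at 1 but positions at 0, hence `suc (k + m)` positions for k + m pipes.
  letter< : ∀ {t} → t < k * m → suc (letter t) < suc (k + m)
  letter< {t} _ = s≤s (+-mono-≤-< (m∸n≤m k (t / m)) (m%n<n t m))

  lex⇒time< : ∀ {a b a′ b′} → a ≤ a′ → b ≤ b′ → a < a′ ⊎ b < b′ → time a b < time a′ b′
  lex⇒time< {a} {b} {a′} {b′} a≤a′ b≤b′ (inj₁ a<a′) =
    +-mono-≤-< b≤b′ (*-monoˡ-< m a<a′)
  lex⇒time< a≤a′ b≤b′ (inj₂ b<b′) = +-mono-<-≤ b<b′ (*-monoˡ-≤ m a≤a′)

  time<⇒row≤ : ∀ {a b a′ b′} → b′ < m → time a b < time a′ b′ → a ≤ a′
  time<⇒row≤ {a} {b} {a′} {b′} b′<m lt with a ≤? a′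
  ... | yes a≤a′ = a≤a′
  ... | no a≰a′  = ⊥-elim (<-asym lt (<-≤-trans (+-monoˡ-< (a′ * m) b′<m)
          (≤-trans (*-monoˡ-≤ m (≰⇒> a≰a′)) (m≤n+m (a * m) b))))

  mutual
    -- `hor` and `ver` are the pipes entering the cell (a , b) from the right and from below. The
    -- base cases number the boundary of the full rectangle from its Northeast corner.
    hor : Cells → ℕ → ℕ → ℕ
    hor T a zero    = k ∸ a
    hor T a (suc b) = if T a b then hor T a b else ver T a b

    ver : Cells → ℕ → ℕ → ℕ
    ver T zero    b = suc (k + b)
    ver T (suc a) b = if T a b then ver T a b else hor T a b

  mutual
    -- Pipes flow Northwest, so only cells weakly Southeast of (a , b) can influence what enters it.
    hor-cong : ∀ {T T′} a b → (∀ i j → i ≤ a → j ≤ b → T i j ≡ T′ i j) → hor T a b ≡ hor T′ a b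
    hor-cong a zero    eq = refl
    hor-cong a (suc b) eq
      rewrite eq a b ≤-refl (n≤1+n b)
            | hor-cong a b (λ i j i≤a j≤b → eq i j i≤a (m≤n⇒m≤1+n j≤b))
            | ver-cong a b (λ i j i≤a j≤b → eq i j i≤a (m≤n⇒m≤1+n j≤b)) = refl

    ver-cong : ∀ {T T′} a b → (∀ i j → i ≤ a → j ≤ b → T i j ≡ T′ i j) → ver T a b ≡ ver T′ a b
    ver-cong zero    b eq = refl
    ver-cong (suc a) b eq
      rewrite eq a b (n≤1+n a) ≤-refl
            | hor-cong a b (λ i j i≤a j≤b → eq i j (m≤n⇒m≤1+n i≤a) j≤b)
            | ver-cong a b (λ i j i≤a j≤b → eq i j (m≤n⇒m≤1+n i≤a) j≤b) = refl

  -- Positions follow the boundary of the read cells from its Northeast end: right edges of the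
  -- untouched rows (`fresh`), tops of the cells read in row a (`above`), the right edge of the next
  -- cell (`current`), bottoms of the cells left in the row (`below`). Pipes that have left on the
  -- left side are not recorded.
  record Frontier (T : Cells) (a b : ℕ) : Set where
    field
      current : state (signal T) (time a b) ((k ∸ a) + b) ≡ hor T a b
      below   : ∀ c → b ≤ c → c < m → state (signal T) (time a b) (suc ((k ∸ a) + c)) ≡ ver T a c
      above   : ∀ c → c < b → state (signal T) (time a b) ((k ∸ a) + c) ≡ ver T (suc a) c
      fresh   : ∀ p → p < k ∸ a → state (signal T) (time a b) p ≡ p
  open Frontier

  state-suc : ∀ T a {b} → b < m → ∀ p →
    state (signal T) (time a (suc b)) p ≡ state (signal T) (time a b) (step (T a b) ((k ∸ a) + b) p)
  state-suc T a b<m p rewrite time-signal T a b<m | time-letter a b<m = refl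

  state-fix : ∀ T a {b} → b < m → ∀ {p} → p ≢ (k ∸ a) + b → p ≢ suc ((k ∸ a) + b) →
    state (signal T) (time a (suc b)) p ≡ state (signal T) (time a b) p
  state-fix T a {b} b<m {p} ≢i ≢1+i = trans (state-suc T a b<m p)
    (cong (state (signal T) (time a b)) (step-fix (T a b) ((k ∸ a) + b) ≢i ≢1+i))

  frontier-step : ∀ T a {b} → b < m → Frontier T a b → Frontier T a (suc b)
  frontier-step T a {b} b<m fr = record
    { current = trans (state-suc T a b<m _) (trans (cong (f ∘ step (T a b) i) (+-suc (k ∸ a) b)) exitLeft)
    ; below   = λ c b<c c<m → trans
        (state-fix T a b<m (>⇒≢ (s≤s (+-monoʳ-≤ (k ∸ a) (<⇒≤ b<c))))
                           (>⇒≢ (s≤s (+-monoʳ-< (k ∸ a) b<c))))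
        (below fr c (<⇒≤ b<c) c<m)
    ; above   = above′
    ; fresh   = λ p p<k → trans
        (state-fix T a b<m (<⇒≢ (<-≤-trans p<k (m≤m+n (k ∸ a) b)))
                           (<⇒≢ (<-≤-trans p<k (m≤n⇒m≤1+n (m≤m+n (k ∸ a) b)))))
        (fresh fr p p<k)
    }
    where
    i : ℕ
    i = (k ∸ a) + b
    f : ℕ → ℕ
    f = state (signal T) (time a b)
    exitLeft : f (step (T a b) i (suc i)) ≡ hor T a (suc b)
    exitLeft with T a b
    ... | true  = trans (cong f (sᵢ-right i)) (current fr)
    ... | false = below fr b ≤-refl b<m
    exitTop : f (step (T a b) i i) ≡ ver T (suc a) b
    exitTop with T a b
    ... | true  = trans (cong f (sᵢ-left i)) (below fr b ≤-refl b<m)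
    ... | false = current fr
    above′ : ∀ c → c < suc b → state (signal T) (time a (suc b)) ((k ∸ a) + c) ≡ ver T (suc a) c
    above′ c c<1+b with c ≟ b
    ... | yes refl = trans (state-suc T a b<m _) exitTop
    ... | no c≢b   = trans (state-fix T a b<m (<⇒≢ c<i) (<⇒≢ (m<n⇒m<1+n c<i))) (above fr c c<b)
      where
      c<b = ≤∧≢⇒< (≤-pred c<1+b) c≢b
      c<i = +-monoʳ-< (k ∸ a) c<b

  -- No letter is read here. The tops of row a become the bottoms of the next row, and the last
  -- fresh position becomes the current one.
  frontier-wrap : ∀ T a → suc a < k → Frontier T a m → Frontier T (suc a) 0
  frontier-wrap T a a<k fr = record
    { current = trans (cong f (+-identityʳ (k ∸ suc a)))
        (fresh fr (k ∸ suc a) (subst (k ∸ suc a <_) (sym k∸a) (n<1+n (k ∸ suc a))))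
    ; below   = λ c _ c<m → trans (cong (λ q → f (q + c)) (sym k∸a)) (above fr c c<m)
    ; above   = λ c ()
    ; fresh   = λ p p<k → fresh fr p (subst (p <_) (sym k∸a) (m<n⇒m<1+n p<k))
    }
    where
    f : ℕ → ℕ
    f = state (signal T) (time a m)
    k∸a : k ∸ a ≡ suc (k ∸ suc a)
    k∸a = ∸-suc-< (<-trans (n<1+n a) a<k)

  frontier : ∀ T a b → a < k → b ≤ m → Frontier T a b
  frontier T zero zero a<k b≤m = record
    { current = +-identityʳ k
    ; below   = λ c _ _ → refl
    ; above   = λ c ()
    ; fresh   = λ p _ → refl
    }
  frontier T (suc a) zero    a<k b≤m = frontier-wrap T a a<k (frontier T a m (<⇒≤ a<k) ≤-refl)
  frontier T a       (suc b) a<k b≤m = frontier-step T a b≤m (frontier T a b a<k (<⇒≤ b≤m))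

  hor-state : ∀ T {a b} → a < k → b < m →
    state (signal T) (time a b) (letter (time a b)) ≡ hor T a b
  hor-state T {a} {b} a<k b<m rewrite time-letter a b<m =
    current (frontier T a b a<k (<⇒≤ b<m))

  ver-state : ∀ T {a b} → a < k → b < m →
    state (signal T) (time a b) (suc (letter (time a b))) ≡ ver T a b
  ver-state T {a} {b} a<k b<m rewrite time-letter a b<m =
    below (frontier T a b a<k (<⇒≤ b<m)) b ≤-refl b<m

  -- The two pipes stand at different positions of one injective state.
  hor≢ver : ∀ T {a b} → a < k → b < m → hor T a b ≢ ver T a b
  hor≢ver T {a} {b} a<k b<m eq = 1+n≢n (sym (state-injective (signal T) (time a b)
    (trans (hor-state T a<k b<m) (trans eq (sym (ver-state T a<k b<m))))))

  -- Pipes never turn back Southeast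

  Enters : Cells → ℕ → ℕ → ℕ → Set
  Enters T x a b = hor T a b ≡ x ⊎ ver T a b ≡ x

  -- When the cell (a , b) is about to be read, the pipe x has already reached column c
  -- (columns counted from the right).
  record Past (T : Cells) (x c a b : ℕ) : Set where
    field
      pos    : ℕ
      pos-x  : state (signal T) (time a b) pos ≡ x
      lower  : (k ∸ a) + c ≤ pos
      strict : b ≤ c → (k ∸ a) + c < pos
  open Past

  enters-pos : ∀ T {x a b} → a < k → b < m → Enters T x a b →
    ∃ λ p → state (signal T) (time a b) p ≡ x × (p ≡ (k ∸ a) + b ⊎ p ≡ suc ((k ∸ a) + b))
  enters-pos T {a = a} {b} a<k b<m (inj₁ h) = (k ∸ a) + b ,
    trans (current (frontier T a b a<k (<⇒≤ b<m))) h , inj₁ refl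
  enters-pos T {a = a} {b} a<k b<m (inj₂ v) = suc ((k ∸ a) + b) ,
    trans (below (frontier T a b a<k (<⇒≤ b<m)) b ≤-refl b<m) v , inj₂ refl

  step-≥ : ∀ β {i l p} → l ≤ i → l ≤ p → l ≤ step β i p
  step-≥ false l≤i l≤p = l≤p
  step-≥ true {i} {p = p} l≤i l≤p with position i p
  ... | left  rewrite sᵢ-left i  = m≤n⇒m≤1+n l≤i
  ... | right rewrite sᵢ-right i = l≤i
  ... | away ≢i ≢1+i rewrite sᵢ-fix i ≢i ≢1+i = l≤p

  -- From column c on, the letters of the row are at least `(k ∸ a) + c`, so no move carries x below
  -- that position.
  past-weak-step : ∀ T {x c} a {b p} → b < m → c ≤ b → (k ∸ a) + c ≤ p →
    state (signal T) (time a b) p ≡ x → Past T x c a (suc b)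
  past-weak-step T a {b} {p} b<m c≤b l≤p fp = record
    { pos    = step (T a b) i p
    ; pos-x  = trans (state-suc T a b<m _)
        (trans (cong (state (signal T) (time a b)) (step-involutive (T a b) i p)) fp)
    ; lower  = step-≥ (T a b) (+-monoʳ-≤ (k ∸ a) c≤b) l≤p
    ; strict = λ b<c → ⊥-elim (<⇒≱ b<c c≤b)
    }
    where
    i : ℕ
    i = (k ∸ a) + b

  past-step : ∀ T {x c} a {b} → b < m → Past T x c a b → Past T x c a (suc b)
  past-step T {x} {c} a {b} b<m pa with c ≤? b
  ... | yes c≤b = past-weak-step T a b<m c≤b (lower pa) (pos-x pa)
  ... | no c≰b  = record
    { pos    = pos pa
    ; pos-x  = trans (state-fix T a b<m (>⇒≢ (<-trans (n<1+n _) far)) (>⇒≢ far)) (pos-x pa)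
    ; lower  = lower pa
    ; strict = λ _ → strict pa (<⇒≤ b<c)
    }
    where
    b<c = ≰⇒> c≰b
    far : suc ((k ∸ a) + b) < pos pa
    far = ≤-<-trans (+-monoʳ-< (k ∸ a) b<c) (strict pa (<⇒≤ b<c))

  past-start : ∀ T {x} {a b} → a < k → b < m → Enters T x a b → Past T x b a (suc b)
  past-start T {a = a} a<k b<m e with enters-pos T a<k b<m e
  ... | p , fp , inj₁ refl = past-weak-step T a b<m ≤-refl ≤-refl fp
  ... | p , fp , inj₂ refl = past-weak-step T a b<m ≤-refl (n≤1+n _) fp

  past-row : ∀ T {x c} a {b b′} → b ≤ b′ → b′ ≤ m → Past T x c a b → Past T x c a b′
  past-row T a {b} {b′} b≤b′ b′≤m pa with b ≟ b′
  past-row T a b≤b′ b′≤m pa | yes refl = pa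
  past-row T a {b′ = zero}   z≤n    b′≤m pa | no b≢b′ = ⊥-elim (b≢b′ refl)
  past-row T a {b′ = suc b′} b≤1+b′ b′<m pa | no b≢b′ =
    past-step T a b′<m (past-row T a (≤-pred (≤∧≢⇒< b≤1+b′ b≢b′)) (<⇒≤ b′<m) pa)

  -- Going up one row lowers the position belonging to column c by one, which makes the weak bound
  -- strict.
  past-wrap : ∀ T {x c} a → a < k → c < m → Past T x c a m → Past T x c (suc a) 0
  past-wrap T {c = c} a a<k c<m pa = record
    { pos    = pos pa
    ; pos-x  = pos-x pa
    ; lower  = <⇒≤ low
    ; strict = λ _ → low
    }
    where
    low : (k ∸ suc a) + c < pos pa
    low = subst (λ q → q + c ≤ pos pa) (∸-suc-< a<k) (lower pa)

  past-rows : ∀ T {x c a a′} → a < a′ → a′ < k → c < m → Past T x c a m → Past T x c a′ 0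
  past-rows T {a = a} {suc a′} a<1+a′ a′<k c<m pa with a ≟ a′
  ... | yes refl = past-wrap T a (<⇒≤ a′<k) c<m pa
  ... | no a≢a′  = past-wrap T a′ (<⇒≤ a′<k) c<m
    (past-row T a′ z≤n ≤-refl
      (past-rows T (≤∧≢⇒< (≤-pred a<1+a′) a≢a′) (<⇒≤ a′<k) c<m pa))

  past-before : ∀ T {x a′ b′} → a′ < k → b′ < m → Enters T x a′ b′ →
    ∀ {c} → Past T x c a′ b′ → c ≤ b′
  past-before T {a′ = a′} {b′} a′<k b′<m e {c} pa with c ≤? b′
  ... | yes c≤b′ = c≤b′
  ... | no c≰b′ with enters-pos T a′<k b′<m e
  ...   | p , fp , p∈ = ⊥-elim (<⇒≱ far (near p∈))
    where
    b′<c = ≰⇒> c≰b′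
    far : suc ((k ∸ a′) + b′) < p
    far = subst (suc ((k ∸ a′) + b′) <_)
      (state-injective (signal T) (time a′ b′) (trans (pos-x pa) (sym fp)))
      (≤-<-trans (+-monoʳ-< (k ∸ a′) b′<c) (strict pa (<⇒≤ b′<c)))
    near : p ≡ (k ∸ a′) + b′ ⊎ p ≡ suc ((k ∸ a′) + b′) → p ≤ suc ((k ∸ a′) + b′)
    near (inj₁ refl) = n≤1+n _
    near (inj₂ refl) = ≤-refl

  -- Reading order by itself only compares the rows. For the columns, x has reached column b after
  -- its first cell and never falls behind it, so it cannot enter a cell further right.
  enters-monotone : ∀ T {x a b a′ b′} → a < k → b < m → a′ < k → b′ < m →
    Enters T x a b → Enters T x a′ b′ → time a b < time a′ b′ →
    a ≤ a′ × b ≤ b′ × (a < a′ ⊎ b < b′)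
  enters-monotone T {x} {a} {b} {a′} {b′} a<k b<m a′<k b′<m e e′ lt with a ≟ a′
  ... | yes refl = ≤-refl , <⇒≤ b<b′ , inj₂ b<b′
    where b<b′ = +-cancelʳ-< (a * m) b b′ lt
  ... | no a≢a′ = <⇒≤ a<a′ , past-before T a′<k b′<m e′ pa , inj₁ a<a′
    where
    a<a′ : a < a′
    a<a′ = ≤∧≢⇒< (time<⇒row≤ b′<m lt) a≢a′
    pa : Past T x b a′ b′
    pa = past-row T a′ z≤n (<⇒≤ b′<m)
      (past-rows T a<a′ a′<k b<m (past-row T a b<m ≤-refl (past-start T a<k b<m e)))

-- Lengths of words

<ᵇ-sound : ∀ {m n} → (m <ᵇ n) ≡ true → m < n
<ᵇ-sound {m} {n} eq = <ᵇ⇒< m n (Equivalence.from T-≡ eq)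

<ᵇ-complete : ∀ {m n} → m < n → (m <ᵇ n) ≡ true
<ᵇ-complete m<n = Equivalence.to T-≡ (<⇒<ᵇ m<n)

<ᵇ-refute : ∀ {m n} → n ≤ m → (m <ᵇ n) ≡ false
<ᵇ-refute {m} {n} n≤m with m <ᵇ n in eq
... | false = refl
... | true  = ⊥-elim (<⇒≱ (<ᵇ-sound eq) n≤m)

≤ᵇ-sound : ∀ {m n} → (m ≤ᵇ n) ≡ true → m ≤ n
≤ᵇ-sound {m} {n} eq = ≤ᵇ⇒≤ m n (Equivalence.from T-≡ eq)

≤ᵇ-complete : ∀ {m n} → m ≤ n → (m ≤ᵇ n) ≡ true
≤ᵇ-complete m≤n = Equivalence.to T-≡ (≤⇒≤ᵇ m≤n)

≡ᵇ-sound : ∀ {m n} → (m ≡ᵇ n) ≡ true → m ≡ n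
≡ᵇ-sound {m} {n} eq = ≡ᵇ⇒≡ m n (Equivalence.from T-≡ eq)

sum-range1 : ∀ g n → sum (map g (range1 n)) ≡ Σ< n (g ∘ suc)
sum-range1 g zero    = refl
sum-range1 g (suc n) = begin
  sum (map g (map suc (upTo (suc n))))             ≡⟨ cong (sum ∘ map g ∘ map suc) (sym (upTo-∷ʳ n)) ⟩
  sum (map g (map suc (upTo n ++ n ∷ [])))         ≡⟨ cong (sum ∘ map g) (map-++ suc (upTo n) (n ∷ [])) ⟩
  sum (map g (range1 n ++ suc n ∷ []))             ≡⟨ cong sum (map-++ g (range1 n) (suc n ∷ [])) ⟩
  sum (map g (range1 n) ++ g (suc n) ∷ [])         ≡⟨ sum-++ (map g (range1 n)) (g (suc n) ∷ []) ⟩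
  sum (map g (range1 n)) + (g (suc n) + 0)         ≡⟨ cong₂ _+_ (sum-range1 g n) (+-identityʳ (g (suc n))) ⟩
  Σ< n (g ∘ suc) + g (suc n)                       ∎
  where open ≡-Reasoning

Σ<-sᵢ : ∀ (g : ℕ → ℕ) {i n} → suc i < n → Σ< n (g ∘ sᵢ (suc i) ∘ suc) ≡ Σ< n (g ∘ suc)
Σ<-sᵢ g {i} {n} i<n = +-cancelʳ-≡ (g (suc i) + g (suc (suc i))) _ _ (trans
  (Σ<-exchange₂ n (<-trans (n<1+n i) i<n) i<n (<⇒≢ (n<1+n i))
    (λ r r≢i r≢1+i → cong g (sᵢ-fix (suc i) (r≢i ∘ suc-injective) (r≢1+i ∘ suc-injective))))
  (cong (Σ< n (g ∘ suc) +_) (trans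
    (cong₂ (λ x y → g x + g y) (sᵢ-left (suc i)) (sᵢ-right (suc i)))
    (+-comm (g (suc (suc i))) (g (suc i))))))

indicator : Bool → ℕ
indicator b = if b then 1 else 0

indicator-mono : ∀ {b c} → (b ≡ true → c ≡ true) → indicator b ≤ indicator c
indicator-mono {false}     b⇒c = z≤n
indicator-mono {true}  {c} b⇒c rewrite b⇒c refl = ≤-refl

∧-true : ∀ {b c} → (b ∧ c) ≡ true → b ≡ true × c ≡ true
∧-true {true} {true} refl = refl , refl

-- Inversions and the length of a product

inversions : ℕ → (ℕ → ℕ) → ℕ
inversions n f = Σ< n λ p → Σ< n λ q →
  indicator ((suc p <ᵇ suc q) ∧ (f (suc q) <ᵇ f (suc p)))

len≡inversions : ∀ n w → len n w ≡ inversions n (evalWord w)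
len≡inversions n w = trans (sum-range1 _ n) (Σ<-cong n λ p _ → sum-range1 _ n)

inversions-cong : ∀ n {f g} → (∀ p → f p ≡ g p) → inversions n f ≡ inversions n g
inversions-cong n eq = Σ<-cong n λ p _ → Σ<-cong n λ q _ →
  cong₂ (λ x y → indicator ((suc p <ᵇ suc q) ∧ (x <ᵇ y))) (eq (suc q)) (eq (suc p))

-- Reindexed by s, the inversions of the product are the pairs with s p < s q and f q < f p. Every
-- inversion of f is among them, since s reverses only the pair at the ascent; that pair in reversed
-- order is new.
inversions-ascent : ∀ {n} f {i} → suc i < n → f (suc i) < f (suc (suc i)) →
  inversions n f < inversions n (f ∘ sᵢ (suc i))
inversions-ascent {n} f {i} i<n ascent = subst (inversions n f <_) (sym reindexed)
  (Σ<-mono-< n (λ p _ → Σ<-mono-≤ n (λ q _ → pointwise (suc p) (suc q))) i<n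
    (Σ<-mono-< n (λ q _ → pointwise (suc (suc i)) (suc q)) (<-trans (n<1+n i) i<n) strict))
  where
  s : ℕ → ℕ
  s = sᵢ (suc i)
  K : ℕ → ℕ → ℕ
  K p q = indicator ((s p <ᵇ s q) ∧ (f q <ᵇ f p))
  reindexed : inversions n (f ∘ s) ≡ Σ< n λ p → Σ< n λ q → K (suc p) (suc q)
  reindexed = trans
    (Σ<-cong n λ p _ → trans
      (Σ<-cong n λ q _ → cong₂ (λ x y → indicator ((x <ᵇ y) ∧ (f (s (suc q)) <ᵇ f (s (suc p)))))
        (sym (sᵢ-involutive (suc i) (suc p))) (sym (sᵢ-involutive (suc i) (suc q))))
      (Σ<-sᵢ (K (s (suc p))) i<n))
    (Σ<-sᵢ (λ p → Σ< n (K p ∘ suc)) i<n)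
  pointwise : ∀ p q → indicator ((p <ᵇ q) ∧ (f q <ᵇ f p)) ≤ K p q
  pointwise p q = indicator-mono λ eq → let (p<q , fq<fp) = ∧-true eq in
    cong₂ _∧_ (<ᵇ-complete (sᵢ-mono-< (suc i) (<ᵇ-sound {p} {q} p<q)
      λ { (refl , refl) → <-asym ascent (<ᵇ-sound fq<fp) })) fq<fp
  strict : indicator ((suc (suc i) <ᵇ suc i) ∧ (f (suc i) <ᵇ f (suc (suc i)))) < K (suc (suc i)) (suc i)
  strict rewrite <ᵇ-refute (n≤1+n i) | sᵢ-right (suc i) | sᵢ-left (suc i)
    | <ᵇ-complete (n<1+n i) | <ᵇ-complete ascent = s≤s z≤n

evalWord-++ : ∀ w w′ p → evalWord (w ++ w′) p ≡ evalWord w (evalWord w′ p)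
evalWord-++ []      w′ p = refl
evalWord-++ (i ∷ w) w′ p = cong (sᵢ i) (evalWord-++ w w′ p)

evalWord-injective : ∀ w → Injective _≡_ _≡_ (evalWord w)
evalWord-injective []      eq = eq
evalWord-injective (i ∷ w) eq = evalWord-injective w (sᵢ-injective i eq)

module _ {n i} (w : List ℕ) (i<n : suc i < n) where
  private
    f : ℕ → ℕ
    f = evalWord w

    len-append : len n (w ++ suc i ∷ []) ≡ inversions n (f ∘ sᵢ (suc i))
    len-append = trans (len≡inversions n (w ++ suc i ∷ []))
      (inversions-cong n (evalWord-++ w (suc i ∷ [])))

  -- A descent of `f` is an ascent of `f` times the transposition, and multiplying twice gives `f`
  -- back.
  len-descent : f (suc (suc i)) < f (suc i) → len n (w ++ suc i ∷ []) < len n w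
  len-descent desc = subst₂ _<_ (sym len-append) (sym (len≡inversions n w))
    (subst (inversions n (f ∘ sᵢ (suc i)) <_)
      (inversions-cong n (λ p → cong f (sᵢ-involutive (suc i) p)))
      (inversions-ascent (f ∘ sᵢ (suc i)) i<n (subst₂ _<_
        (cong f (sym (sᵢ-left (suc i)))) (cong f (sym (sᵢ-right (suc i)))) desc)))

  descent-len : len n (w ++ suc i ∷ []) < len n w → f (suc (suc i)) < f (suc i)
  descent-len lt with <-cmp (f (suc i)) (f (suc (suc i)))
  ... | tri< asc _ _ = ⊥-elim (<-asym lt (subst₂ _<_ (sym (len≡inversions n w)) (sym len-append)
                         (inversions-ascent f i<n asc)))
  ... | tri≈ _ eq _  = ⊥-elim (1+n≢n (sym (evalWord-injective w eq)))
  ... | tri> _ _ desc = desc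

-- Words read off a rectangle

module _ {A : Set} where

  concatMap-filterᵇ : ∀ (f : ℕ → List A) p xs →
    concatMap f (filterᵇ p xs) ≡ concatMap (λ x → if p x then f x else []) xs
  concatMap-filterᵇ f p []       = refl
  concatMap-filterᵇ f p (x ∷ xs) with p x
  ... | true  = cong (f x ++_) (concatMap-filterᵇ f p xs)
  ... | false = concatMap-filterᵇ f p xs

  concatMap-[] : ∀ (xs : List ℕ) → concatMap {B = A} (λ _ → []) xs ≡ []
  concatMap-[] []       = refl
  concatMap-[] (x ∷ xs) = concatMap-[] xs

  -- Serves to lengthen the rows of the shape to all m columns, the added cells contributing empty
  -- words.
  concatMap-downFrom-extend : ∀ (f : ℕ → List A) {l} n → l ≤ n → (∀ x → l ≤ x → f x ≡ []) →
    concatMap f (downFrom l) ≡ concatMap f (downFrom n)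
  concatMap-downFrom-extend f {l} n l≤n nil with l ≟ n
  ... | yes refl = refl
  concatMap-downFrom-extend f zero    z≤n   nil | no l≢n = refl
  concatMap-downFrom-extend f (suc n) l≤1+n nil | no l≢n =
    trans (concatMap-downFrom-extend f n l≤n nil) (cong (_++ concatMap f (downFrom n)) (sym (nil n l≤n)))
    where l≤n = ≤-pred (≤∧≢⇒< l≤1+n l≢n)

-- A telescoping product with `φ b` as the state at moment b. As `downFrom n` starts with its
-- largest entry, the block of index `n ∸ suc b` leads from b to b + 1. It is applied to the cells
-- of a row and to the rows.
evalWord-downFrom : ∀ (g : ℕ → List ℕ) n {φ : ℕ → ℕ → ℕ} →
  (∀ {b} → b < n → ∀ p → φ b (evalWord (g (n ∸ suc b)) p) ≡ φ (suc b) p) →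
  ∀ p → φ 0 (evalWord (concatMap g (downFrom n)) p) ≡ φ n p
evalWord-downFrom g zero    eq p = refl
evalWord-downFrom g (suc n) {φ} eq p = begin
  φ 0 (evalWord (g n ++ concatMap g (downFrom n)) p)            ≡⟨ cong (φ 0) (evalWord-++ (g n) _ p) ⟩
  φ 0 (evalWord (g n) (evalWord (concatMap g (downFrom n)) p))  ≡⟨ eq (s≤s z≤n) _ ⟩
  φ 1 (evalWord (concatMap g (downFrom n)) p)                   ≡⟨ evalWord-downFrom g n {φ ∘ suc} (eq ∘ s≤s) p ⟩
  φ (suc n) p                                                   ∎
  where open ≡-Reasoning

module Reading (k m : ℕ) .{{_ : NonZero m}} where
  open Grid k m

  evalWord-rectangle : ∀ T (g : ℕ → ℕ → List ℕ) →
    (∀ {a b} → a < k → b < m → ∀ p →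
      evalWord (g (k ∸ suc a) (m ∸ suc b)) p ≡ step (T a b) ((k ∸ a) + b) p) →
    ∀ p → evalWord (concatMap (λ r → concatMap (g r) (downFrom m)) (downFrom k)) p
        ≡ state (signal T) (time k 0) p
  evalWord-rectangle T g eq =
    evalWord-downFrom (λ r → concatMap (g r) (downFrom m)) k {λ a → state (signal T) (time a 0)}
      (λ {a} a<k → evalWord-downFrom (g (k ∸ suc a)) m {λ b → state (signal T) (time a b)}
        (λ {b} b<m p → trans (cong (state (signal T) (time a b)) (eq a<k b<m p))
          (sym (state-suc T a b<m p))))

  state-idle : ∀ τ {s} t → s ≤ t → (∀ r → s ≤ r → r < t → τ r ≡ false) →
    ∀ p → state τ t p ≡ state τ s p
  state-idle τ {s} t s≤t idle p with s ≟ t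
  ... | yes refl = refl
  state-idle τ zero    z≤n   idle p | no s≢t = ⊥-elim (s≢t refl)
  state-idle τ {s} (suc t) s≤1+t idle p | no s≢t rewrite idle t (≤-pred (≤∧≢⇒< s≤1+t s≢t)) (n<1+n t) =
    state-idle τ t (≤-pred (≤∧≢⇒< s≤1+t s≢t)) (λ r s≤r r<t → idle r s≤r (m<n⇒m<1+n r<t)) p

mirror< : ∀ {n i} → i < n → n ∸ suc i < n
mirror< {suc n} {i} i<n = s≤s (m∸n≤m n i)

mirror-involutive : ∀ {n i} → i < n → n ∸ suc (n ∸ suc i) ≡ i
mirror-involutive {suc n} (s≤s i≤n) = m∸[m∸n]≡n i≤n

count-prefix : ∀ {n} (f : Fin n → Bool) j → j ≤ n →
  (∀ i → toℕ i < j → f i ≡ true) → (∀ i → j ≤ toℕ i → f i ≡ false) →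
  sum (tabulate (indicator ∘ f)) ≡ j
count-prefix {zero}  f zero    _         on off = refl
count-prefix {suc n} f zero    _         on off rewrite off zero z≤n =
  count-prefix (f ∘ suc) 0 z≤n (λ _ ()) (λ i _ → off (suc i) z≤n)
count-prefix {suc n} f (suc j) (s≤s j≤n) on off rewrite on zero (s≤s z≤n) =
  cong suc (count-prefix (f ∘ suc) j j≤n (λ i i<j → on (suc i) (s≤s i<j)) (λ i j≤i → off (suc i) (s≤s j≤i)))

-- Ferrers shapes inside the rectangle

module Ferrers {k m : ℕ} .{{_ : NonZero m}} (sh : Shape k m) where
  open Shape sh
  open Grid k m
  open Reading k m

  rowℕ-fromℕ< : ∀ {r} (r<k : r < k) → rowℕ sh r ≡ row (fromℕ< r<k)
  rowℕ-fromℕ< {r} r<k with r <? k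
  ... | yes _  = refl
  ... | no r≮k = ⊥-elim (r≮k r<k)

  rowℕ-toℕ : ∀ i → rowℕ sh (toℕ i) ≡ row i
  rowℕ-toℕ i = trans (rowℕ-fromℕ< (toℕ<n i)) (cong row (fromℕ<-toℕ i (toℕ<n i)))

  rowℕ≤m : ∀ r → rowℕ sh r ≤ m
  rowℕ≤m r with r <? k
  ... | yes r<k = row≤ (fromℕ< r<k)
  ... | no _    = z≤n

  rowℕ-anti : ∀ {r r′} → r ≤ r′ → rowℕ sh r′ ≤ rowℕ sh r
  rowℕ-anti {r} {r′} r≤r′ with r′ <? k
  ... | no _     = z≤n
  ... | yes r′<k rewrite rowℕ-fromℕ< (≤-<-trans r≤r′ r′<k) =
    mono _ _ (subst₂ _≤_ (sym (toℕ-fromℕ< (≤-<-trans r≤r′ r′<k))) (sym (toℕ-fromℕ< r′<k)) r≤r′)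

  rowOf<k : ∀ d → rowOf sh d < k
  rowOf<k (r , c) = toℕ<n r

  colOf<row : ∀ d → colOf sh d < rowℕ sh (rowOf sh d)
  colOf<row (r , c) rewrite rowℕ-toℕ r = toℕ<n c

  colOf<m : ∀ d → colOf sh d < m
  colOf<m d = <-≤-trans (colOf<row d) (rowℕ≤m (rowOf sh d))

  box-≡ : ∀ {r r′} (q : r′ ≡ r) (c : Fin (row r)) (c<r : toℕ c < row r′) →
    _≡_ {A = Box sh} (r′ , fromℕ< c<r) (r , c)
  box-≡ refl c c<r = cong (_ ,_) (fromℕ<-toℕ c c<r)

  at-box : ∀ D d → at sh D (rowOf sh d) (colOf sh d) ≡ just (D d)
  at-box D (r , c) with toℕ r <? k
  ... | no r≮k = ⊥-elim (r≮k (toℕ<n r))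
  ... | yes r<k with toℕ c <? row (fromℕ< r<k)
  ...   | yes c<row = cong (just ∘ D) (box-≡ (fromℕ<-toℕ r r<k) c c<row)
  ...   | no c≮row  = ⊥-elim (c≮row
    (subst (λ i → toℕ c < row i) (sym (fromℕ<-toℕ r r<k)) (toℕ<n c)))

  at-nonbox : ∀ D r c → rowℕ sh r ≤ c → at sh D r c ≡ nothing
  at-nonbox D r c row≤c with r <? k
  ... | no _ = refl
  ... | yes r<k with c <? row (fromℕ< r<k)
  ...   | yes c<row = ⊥-elim (<⇒≱ c<row row≤c)
  ...   | no _      = refl

  box : ∀ {r c} → c < rowℕ sh r → ∃ λ d → rowOf sh d ≡ r × colOf sh d ≡ c
  box {r} {c} c<row with r <? k
  ... | yes r<k = (fromℕ< r<k , fromℕ< c<row) , toℕ-fromℕ< r<k , toℕ-fromℕ< c<row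
  box () | no _

  at-inside : ∀ D {r c} → c < rowℕ sh r → ∃ λ t → at sh D r c ≡ just t
  at-inside D c<row with d , refl , refl ← box c<row = D d , at-box D d

  colℕ-count : ∀ {j c} → j ≤ k → (∀ r → r < j → c < rowℕ sh r) → (∀ r → j ≤ r → rowℕ sh r ≤ c) →
    colℕ sh c ≡ j
  colℕ-count {j} {c} j≤k on off = trans
    (cong sum (map-tabulate (λ i → i) (λ i → indicator (c <ᵇ row i))))
    (count-prefix (λ i → c <ᵇ row i) j j≤k
      (λ i i<j → <ᵇ-complete (subst (c <_) (rowℕ-toℕ i) (on (toℕ i) i<j)))
      (λ i j≤i → <ᵇ-refute (subst (_≤ c) (rowℕ-toℕ i) (off (toℕ i) j≤i))))

  -- Row from the bottom and column from the right: the order in which the pipes flow.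
  rowUp colLeft : Box sh → ℕ
  rowUp d    = k ∸ suc (rowOf sh d)
  colLeft d = m ∸ suc (colOf sh d)

  up<k : ∀ d → rowUp d < k
  up<k d = mirror< (rowOf<k d)

  left<m : ∀ d → colLeft d < m
  left<m d = mirror< (colOf<m d)

  stoneAt : Maybe Tile → Bool
  stoneAt nothing  = false
  stoneAt (just t) = isStone t

  -- Outside the shape every cell is a plus, so the pipe that starts at position p of the
  -- rectangle stays at position p until it meets the lattice path at the step labelled p.
  cells : Diagram sh → Cells
  cells D a b = stoneAt (at sh D (k ∸ suc a) (m ∸ suc b))

  cells-box : ∀ D d → cells D (rowUp d) (colLeft d) ≡ isStone (D d)
  cells-box D d rewrite mirror-involutive (rowOf<k d) | mirror-involutive (colOf<m d) | at-box D d = refl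

  cells-nonbox : ∀ D a b → rowℕ sh (k ∸ suc a) ≤ m ∸ suc b → cells D a b ≡ false
  cells-nonbox D a b out rewrite at-nonbox D (k ∸ suc a) (m ∸ suc b) out = refl

  box-at : ∀ {a b} → a < k → b < m → m ∸ suc b < rowℕ sh (k ∸ suc a) →
    ∃ λ d → rowUp d ≡ a × colLeft d ≡ b
  box-at {a} {b} a<k b<m inside with box {k ∸ suc a} inside
  ... | d , r≡ , c≡ = d , trans (cong (λ r → k ∸ suc r) r≡) (mirror-involutive a<k)
                        , trans (cong (λ c → m ∸ suc c) c≡) (mirror-involutive b<m)

  stone-box : ∀ D {a b} → a < k → b < m → cells D a b ≡ true → ∃ λ d → rowUp d ≡ a × colLeft d ≡ b
  stone-box D {a} {b} a<k b<m stone with m ∸ suc b <? rowℕ sh (k ∸ suc a)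
  ... | yes inside = box-at a<k b<m inside
  ... | no outside with () ← trans (sym stone) (cells-nonbox D a b (≮⇒≥ outside))

  -- Agreement of the pipes of the rectangle with the pipe dream

  mutual
    -- The neighbours to the right and below are outside too, as row lengths decrease; an elbow
    -- passes a pipe from one edge to another of the same position.
    hor-outside : ∀ D a b → a < k → b < m → rowℕ sh (k ∸ suc a) ≤ m ∸ suc b →
      hor (cells D) a b ≡ (k ∸ a) + b
    hor-outside D a zero    a<k b<m out = sym (+-identityʳ (k ∸ a))
    hor-outside D a (suc b) a<k b<m out with out′ ← ≤-trans out (∸-monoʳ-≤ m (n≤1+n (suc b))) rewrite cells-nonbox D a b out′ =
      trans (ver-outside D a b a<k (<⇒≤ b<m) out′) (sym (+-suc (k ∸ a) b))

    ver-outside : ∀ D a b → a < k → b < m → rowℕ sh (k ∸ suc a) ≤ m ∸ suc b →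
      ver (cells D) a b ≡ suc ((k ∸ a) + b)
    ver-outside D zero    b a<k b<m out = refl
    ver-outside D (suc a) b a<k b<m out with out′ ← ≤-trans (rowℕ-anti (∸-monoʳ-≤ k (n≤1+n (suc a)))) out rewrite cells-nonbox D a b out′ =
      trans (hor-outside D a b (<⇒≤ a<k) b<m out′) (cong (_+ b) (∸-suc-< (<⇒≤ a<k)))

  vStep-value : ∀ {a b} → a < k → b ≤ m → rowℕ sh (k ∸ suc a) ≡ m ∸ b →
    vStep sh (k ∸ suc a) ≡ (k ∸ a) + b
  vStep-value {a} {b} a<k b≤m row≡ = begin
    (m ∸ rowℕ sh (k ∸ suc a)) + (k ∸ suc a) + 1 ≡⟨ cong (λ z → (m ∸ z) + (k ∸ suc a) + 1) row≡ ⟩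
    (m ∸ (m ∸ b)) + (k ∸ suc a) + 1             ≡⟨ cong (λ z → z + (k ∸ suc a) + 1) (m∸[m∸n]≡n b≤m) ⟩
    b + (k ∸ suc a) + 1                         ≡⟨ +-assoc b (k ∸ suc a) 1 ⟩
    b + ((k ∸ suc a) + 1)                       ≡⟨ cong (b +_) (+-comm (k ∸ suc a) 1) ⟩
    b + suc (k ∸ suc a)                         ≡⟨ cong (b +_) (sym (∸-suc-< a<k)) ⟩
    b + (k ∸ a)                                 ≡⟨ +-comm b (k ∸ a) ⟩
    (k ∸ a) + b                                 ∎
    where open ≡-Reasoning

  hStep-value : ∀ {a b} → b < m → colℕ sh (m ∸ suc b) ≡ k ∸ a →
    hStep sh (m ∸ suc b) ≡ suc ((k ∸ a) + b)
  hStep-value {a} {b} b<m col≡ = begin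
    (m ∸ suc (m ∸ suc b)) + colℕ sh (m ∸ suc b) + 1 ≡⟨ cong₂ (λ x y → x + y + 1) (mirror-involutive b<m) col≡ ⟩
    b + (k ∸ a) + 1                                 ≡⟨ +-comm (b + (k ∸ a)) 1 ⟩
    suc (b + (k ∸ a))                               ≡⟨ cong suc (+-comm b (k ∸ a)) ⟩
    suc ((k ∸ a) + b)                               ∎
    where open ≡-Reasoning

  mutual
    -- The right edge of a box lies on the side of the rectangle, on the lattice path, or between
    -- two boxes. On the path the pipe arrives with its position as label, which is the number of
    -- that step; between boxes both recursions agree.
    hor≡H : ∀ D a b → a < k → b < m → m ∸ suc b < rowℕ sh (k ∸ suc a) →
      hor (cells D) a b ≡ H sh D (suc a) b
    hor≡H D a zero a<k b<m inside = sym (trans (vStep-value a<k z≤n row≡m) (+-identityʳ (k ∸ a)))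
      where
      row≡m : rowℕ sh (k ∸ suc a) ≡ m
      row≡m = ≤-antisym (rowℕ≤m _) (subst (_≤ rowℕ sh (k ∸ suc a)) (sym (∸-suc-< b<m)) inside)
    hor≡H D a (suc b) a<k b<m inside with m ∸ suc b <? rowℕ sh (k ∸ suc a)
    ... | no outside rewrite at-nonbox D (k ∸ suc a) (m ∸ suc b) (≮⇒≥ outside) =
      trans (ver-outside D a b a<k (<⇒≤ b<m) (≮⇒≥ outside))
        (trans (sym (+-suc (k ∸ a) b)) (sym (vStep-value a<k (<⇒≤ b<m) row≡)))
      where
      row≡ : rowℕ sh (k ∸ suc a) ≡ m ∸ suc b
      row≡ = ≤-antisym (≮⇒≥ outside) (subst (_≤ rowℕ sh (k ∸ suc a)) (sym (∸-suc-< b<m)) inside)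
    ... | yes in′ with at-inside D in′
    ...   | t , at≡ rewrite at≡
          | hor≡H D a b a<k (<⇒≤ b<m) in′ | ver≡V D a b a<k (<⇒≤ b<m) in′ = refl

    ver≡V : ∀ D a b → a < k → b < m → m ∸ suc b < rowℕ sh (k ∸ suc a) →
      ver (cells D) a b ≡ V sh D a (suc b)
    ver≡V D zero b a<k b<m inside = sym (hStep-value {0} b<m (colℕ-count ≤-refl
      (λ r r<k → <-≤-trans inside (rowℕ-anti (≤-pred (subst (r <_) (∸-suc-< a<k) r<k))))
      (λ r k≤r → ≤-trans (≤-reflexive (rowℕ-none k≤r)) z≤n)))
      where
      rowℕ-none : ∀ {r} → k ≤ r → rowℕ sh r ≡ 0
      rowℕ-none {r} k≤r with r <? k
      ... | yes r<k = ⊥-elim (<⇒≱ r<k k≤r)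
      ... | no _    = refl
    ver≡V D (suc a) b a<k b<m inside with m ∸ suc b <? rowℕ sh (k ∸ suc a)
    ... | no outside rewrite at-nonbox D (k ∸ suc a) (m ∸ suc b) (≮⇒≥ outside) =
      trans (hor-outside D a b (<⇒≤ a<k) b<m (≮⇒≥ outside))
        (trans (cong (_+ b) (∸-suc-< (<⇒≤ a<k))) (sym (hStep-value {suc a} b<m (colℕ-count (m∸n≤m k (suc a))
          (λ r r<j → <-≤-trans inside (rowℕ-anti (≤-pred (subst (r <_) (∸-suc-< a<k) r<j))))
          (λ r j≤r → ≤-trans (rowℕ-anti j≤r) (≮⇒≥ outside))))))
    ... | yes in′ with at-inside D in′
    ...   | t , at≡ rewrite at≡
          | hor≡H D a b (<⇒≤ a<k) b<m in′ | ver≡V D a b (<⇒≤ a<k) b<m in′ = refl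

  stamp : Box sh → ℕ
  stamp d = time (rowUp d) (colLeft d)

  stamp< : ∀ d → stamp d < k * m
  stamp< d = time< (up<k d) (left<m d)

  inside : ∀ d → m ∸ suc (colLeft d) < rowℕ sh (k ∸ suc (rowUp d))
  inside d rewrite mirror-involutive (rowOf<k d) | mirror-involutive (colOf<m d) = colOf<row d

  fromRight≡hor : ∀ D d → fromRight sh D d ≡ hor (cells D) (rowUp d) (colLeft d)
  fromRight≡hor D d rewrite ∸-suc-< (rowOf<k d) =
    sym (hor≡H D (rowUp d) (colLeft d) (up<k d) (left<m d) (inside d))

  fromBelow≡ver : ∀ D d → fromBelow sh D d ≡ ver (cells D) (rowUp d) (colLeft d)
  fromBelow≡ver D d rewrite ∸-suc-< (colOf<m d) =
    sym (ver≡V D (rowUp d) (colLeft d) (up<k d) (left<m d) (inside d))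

  fromRight≢fromBelow : ∀ D d → fromRight sh D d ≢ fromBelow sh D d
  fromRight≢fromBelow D d eq = hor≢ver (cells D) (up<k d) (left<m d)
    (trans (sym (fromRight≡hor D d)) (trans eq (fromBelow≡ver D d)))

  -- Descents are inversions of the two entering pipes

  label≡ : ∀ {a b} → a < k → b < m → boxLabel sh (k ∸ suc a) (m ∸ suc b) ≡ (k ∸ a) + b
  label≡ {a} {b} a<k b<m = begin
    (m ∸ (m ∸ suc b)) + (k ∸ suc a) ≡⟨ cong (_+ (k ∸ suc a)) (m∸[m∸n]≡n b<m) ⟩
    suc (b + (k ∸ suc a))           ≡⟨ sym (+-suc b (k ∸ suc a)) ⟩
    b + suc (k ∸ suc a)             ≡⟨ cong (b +_) (sym (∸-suc-< a<k)) ⟩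
    b + (k ∸ a)                     ≡⟨ +-comm b (k ∸ a) ⟩
    (k ∸ a) + b                     ∎
    where open ≡-Reasoning

  module _ (D : Diagram sh) (d : Box sh) where
    private
      r c : ℕ
      r = rowOf sh d
      c = colOf sh d

    guard : ℕ → ℕ → Bool
    guard r′ c′ = (c ≤ᵇ c′) ∧ (r ≤ᵇ r′)

    -- Erasing all stones but those of the region weakly right of and weakly below d turns the word
    -- of that region into a word of the whole rectangle, and leaves the pipes entering d as they
    -- were.
    restricted : Cells
    restricted a b = guard (k ∸ suc a) (m ∸ suc b) ∧ cells D a b

    cellWord : ℕ → ℕ → List ℕ
    cellWord r′ c′ = if guard r′ c′ then stoneLetter sh (at sh D r′ c′) (boxLabel sh r′ c′) else []

    wordIn≡ : wordIn sh D r c ≡ concatMap (λ r′ → concatMap (cellWord r′) (downFrom m)) (downFrom k)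
    wordIn≡ = trans (concatMap-filterᵇ _ (r ≤ᵇ_) (downFrom k)) (concatMap-cong rowWord (downFrom k))
      where
      rowWord : ∀ r′ → (if r ≤ᵇ r′ then concatMap (λ c′ → stoneLetter sh (at sh D r′ c′) (boxLabel sh r′ c′))
                                               (filterᵇ (c ≤ᵇ_) (downFrom (rowℕ sh r′))) else [])
                     ≡ concatMap (cellWord r′) (downFrom m)
      rowWord r′ with r ≤ᵇ r′
      ... | true  = trans (concatMap-filterᵇ _ (c ≤ᵇ_) (downFrom (rowℕ sh r′)))
        (trans (concatMap-cong (λ c′ → cong (if_then _ else []) (sym (∧-identityʳ (c ≤ᵇ c′)))) (downFrom (rowℕ sh r′)))
          (concatMap-downFrom-extend _ m (rowℕ≤m r′) nil))
        where
        nil : ∀ c′ → rowℕ sh r′ ≤ c′ →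
          (if (c ≤ᵇ c′) ∧ true then stoneLetter sh (at sh D r′ c′) (boxLabel sh r′ c′) else []) ≡ []
        nil c′ out rewrite at-nonbox D r′ c′ out with (c ≤ᵇ c′) ∧ true
        ... | true  = refl
        ... | false = refl
      ... | false = sym (trans
        (concatMap-cong (λ c′ → cong (if_then _ else []) (∧-zeroʳ (c ≤ᵇ c′))) (downFrom m))
        (concatMap-[] (downFrom m)))

    evalWord-cell : ∀ {a b} → a < k → b < m → ∀ p →
      evalWord (cellWord (k ∸ suc a) (m ∸ suc b)) p ≡ step (restricted a b) ((k ∸ a) + b) p
    evalWord-cell {a} {b} a<k b<m p with guard (k ∸ suc a) (m ∸ suc b)
    ... | false = refl
    ... | true with at sh D (k ∸ suc a) (m ∸ suc b)
    ...   | nothing = refl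
    ...   | just t with isStone t
    ...     | true  = cong (λ i → sᵢ i p) (label≡ a<k b<m)
    ...     | false = refl

    guard-inside : ∀ {a b} → a ≤ rowUp d → b ≤ colLeft d → guard (k ∸ suc a) (m ∸ suc b) ≡ true
    guard-inside a≤ b≤ = cong₂ _∧_
      (≤ᵇ-complete (subst (_≤ _) (mirror-involutive (colOf<m d)) (∸-monoʳ-≤ m (s≤s b≤))))
      (≤ᵇ-complete (subst (_≤ _) (mirror-involutive (rowOf<k d)) (∸-monoʳ-≤ k (s≤s a≤))))

    restricted-inside : ∀ a b → a ≤ rowUp d → b ≤ colLeft d → restricted a b ≡ cells D a b
    restricted-inside a b a≤ b≤ = cong (_∧ cells D a b) (guard-inside a≤ b≤)

    -- A cell that is kept has both coordinates at most those of d, hence is read no later than d.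
    restricted-outside : ∀ t → stamp d < t → t < k * m → signal restricted t ≡ false
    restricted-outside t d<t t<km with signal restricted t in eq
    ... | false = refl
    ... | true with g , _ ← ∧-true eq with c≤ , r≤ ← ∧-true {c ≤ᵇ _} g =
      ⊥-elim (<⇒≱ d<t (subst (_≤ stamp d) (time-inverse t) (+-mono-≤
        (subst (_≤ colLeft d) (mirror-involutive (m%n<n t m)) (∸-monoʳ-≤ m (s≤s (≤ᵇ-sound c≤))))
        (*-monoˡ-≤ m (subst (_≤ rowUp d) (mirror-involutive (row< t<km)) (∸-monoʳ-≤ k (s≤s (≤ᵇ-sound {r} r≤))))))))

    sOf≡ : sOf sh d ≡ (k ∸ rowUp d) + colLeft d
    sOf≡ = trans (cong₂ (boxLabel sh) (sym (mirror-involutive (rowOf<k d))) (sym (mirror-involutive (colOf<m d))))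
      (label≡ (up<k d) (left<m d))

    evalWord-wordIn : ∀ p → evalWord (wordIn sh D r c) p
      ≡ state (signal restricted) (stamp d) (step (isStone (D d)) (sOf sh d) p)
    evalWord-wordIn p = begin
      evalWord (wordIn sh D r c) p
        ≡⟨ cong (λ w → evalWord w p) wordIn≡ ⟩
      evalWord (concatMap (λ r′ → concatMap (cellWord r′) (downFrom m)) (downFrom k)) p
        ≡⟨ evalWord-rectangle restricted cellWord evalWord-cell p ⟩
      state (signal restricted) (k * m) p
        ≡⟨ state-idle (signal restricted) (k * m) (stamp< d) restricted-outside p ⟩
      state (signal restricted) (suc (stamp d)) p
        ≡⟨ state-suc restricted (rowUp d) (left<m d) p ⟩
      state (signal restricted) (stamp d) (step (restricted (rowUp d) (colLeft d)) ((k ∸ rowUp d) + colLeft d) p)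
        ≡⟨ cong (state (signal restricted) (stamp d)) (cong₂ (λ β i → step β i p)
             (trans (restricted-inside (rowUp d) (colLeft d) ≤-refl ≤-refl) (cells-box D d)) (sym sOf≡)) ⟩
      state (signal restricted) (stamp d) (step (isStone (D d)) (sOf sh d) p) ∎
      where open ≡-Reasoning

    -- The stone of d, if there is one, is the last letter of `wordIn`; repeating it cancels it, so
    -- the product is the state just before d is read.
    evalWord-before : ∀ p → evalWord (wordIn sh D r c ++ uWord sh D d) p ≡ state (signal restricted) (stamp d) p
    evalWord-before p = trans (evalWord-++ (wordIn sh D r c) (uWord sh D d) p)
      (trans (evalWord-wordIn _) (cong (state (signal restricted) (stamp d)) cancel))
      where
      cancel : step (isStone (D d)) (sOf sh d) (evalWord (uWord sh D d) p) ≡ p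
      cancel with isStone (D d)
      ... | true  = sᵢ-involutive (sOf sh d) p
      ... | false = refl

    sOf-letter : sOf sh d ≡ letter (stamp d)
    sOf-letter = trans sOf≡ (sym (time-letter (rowUp d) (left<m d)))

    entering-right : evalWord (wordIn sh D r c ++ uWord sh D d) (sOf sh d) ≡ fromRight sh D d
    entering-right = begin
      evalWord (wordIn sh D r c ++ uWord sh D d) (sOf sh d)         ≡⟨ evalWord-before (sOf sh d) ⟩
      state (signal restricted) (stamp d) (sOf sh d)                ≡⟨ cong (state (signal restricted) (stamp d)) sOf-letter ⟩
      state (signal restricted) (stamp d) (letter (stamp d))        ≡⟨ hor-state restricted (up<k d) (left<m d) ⟩
      hor restricted (rowUp d) (colLeft d)                               ≡⟨ hor-cong (rowUp d) (colLeft d) restricted-inside ⟩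
      hor (cells D) (rowUp d) (colLeft d)                                ≡⟨ sym (fromRight≡hor D d) ⟩
      fromRight sh D d                                              ∎
      where open ≡-Reasoning

    entering-below : evalWord (wordIn sh D r c ++ uWord sh D d) (suc (sOf sh d)) ≡ fromBelow sh D d
    entering-below = begin
      evalWord (wordIn sh D r c ++ uWord sh D d) (suc (sOf sh d))   ≡⟨ evalWord-before (suc (sOf sh d)) ⟩
      state (signal restricted) (stamp d) (suc (sOf sh d))          ≡⟨ cong (state (signal restricted) (stamp d) ∘ suc) sOf-letter ⟩
      state (signal restricted) (stamp d) (suc (letter (stamp d)))  ≡⟨ ver-state restricted (up<k d) (left<m d) ⟩
      ver restricted (rowUp d) (colLeft d)                               ≡⟨ ver-cong (rowUp d) (colLeft d) restricted-inside ⟩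
      ver (cells D) (rowUp d) (colLeft d)                                ≡⟨ sym (fromBelow≡ver D d) ⟩
      fromBelow sh D d                                              ∎
      where open ≡-Reasoning

    private
      w : List ℕ
      w = wordIn sh D r c ++ uWord sh D d
      i : ℕ
      -- One less than the letter of d, because the length lemmas are about letters `suc i`.
      i = colLeft d + r
      sOf-suc : sOf sh d ≡ suc i
      sOf-suc = cong (_+ r) (∸-suc-< (colOf<m d))
      i< : suc i < N sh
      i< = subst (_< N sh) sOf-suc (subst (sOf sh d <_) (+-comm m k)
             (+-mono-≤-< (m∸n≤m m c) (rowOf<k d)))

    inverted⇒descent : fromBelow sh D d < fromRight sh D d → Descent sh D d
    inverted⇒descent lt = subst (λ s → len (N sh) (w ++ s ∷ []) < len (N sh) w) (sym sOf-suc)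
      (len-descent w i< (subst (λ s → evalWord w (suc s) < evalWord w s) sOf-suc
        (subst₂ _<_ (sym entering-below) (sym entering-right) lt)))

    descent⇒inverted : Descent sh D d → fromBelow sh D d < fromRight sh D d
    descent⇒inverted desc = subst₂ _<_ entering-below entering-right
      (subst (λ s → evalWord w (suc s) < evalWord w s) (sym sOf-suc)
        (descent-len w i< (subst (λ s → len (N sh) (w ++ s ∷ []) < len (N sh) w) sOf-suc desc)))

  -- Colours

  paint : Bool → Bool → Tile
  paint false crossing = plus
  paint true  crossing = if crossing then white else black

  recolor≡paint : ∀ D d → recolor sh D d ≡ paint (isStone (D d)) (fromRight sh D d <ᵇ fromBelow sh D d)
  recolor≡paint D d with D d
  ... | black = refl
  ... | white = refl
  ... | plus  = refl

  isStone-paint : ∀ s c → isStone (paint s c) ≡ s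
  isStone-paint false c     = refl
  isStone-paint true  true  = refl
  isStone-paint true  false = refl

  isStone-recolor : ∀ D d → isStone (recolor sh D d) ≡ isStone (D d)
  isStone-recolor D d = trans (cong isStone (recolor≡paint D d)) (isStone-paint (isStone (D d)) _)

  cells-cong : ∀ {D E : Diagram sh} → (∀ d → isStone (D d) ≡ isStone (E d)) → ∀ a b → cells D a b ≡ cells E a b
  cells-cong {D} {E} eq a b with m ∸ suc b <? rowℕ sh (k ∸ suc a)
  ... | yes in′ with d , r≡ , c≡ ← box {k ∸ suc a} in′
    rewrite sym r≡ | sym c≡ | at-box D d | at-box E d = eq d
  cells-cong {D} {E} eq a b | no outside
    rewrite cells-nonbox D a b (≮⇒≥ outside) | cells-nonbox E a b (≮⇒≥ outside) = refl

  -- The course of the pipes depends on where the stones are, not on their colours.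
  recolor-cong : ∀ {D E : Diagram sh} → (∀ d → isStone (D d) ≡ isStone (E d)) → ∀ d → recolor sh D d ≡ recolor sh E d
  recolor-cong {D} {E} eq d = trans (recolor≡paint D d) (trans
    (cong₂ paint (eq d) (cong₂ _<ᵇ_
      (trans (fromRight≡hor D d) (trans (hor-cong (rowUp d) (colLeft d) λ a b _ _ → cells-cong eq a b) (sym (fromRight≡hor E d))))
      (trans (fromBelow≡ver D d) (trans (ver-cong (rowUp d) (colLeft d) λ a b _ _ → cells-cong eq a b) (sym (fromBelow≡ver E d))))))
    (sym (recolor≡paint E d)))

  flip-wellColored : ∀ {D D′} → Flip sh D D′ → WellColored sh D′
  flip-wellColored {D} {D′} (b , _ , _ , _ , _ , e , _ , D′≡) d = trans (D′≡ d)
    (sym (recolor-cong {D′} {exchange sh D b e} (λ d′ → trans (cong isStone (D′≡ d′)) (isStone-recolor (exchange sh D b e) d′)) d))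

  -- Meetings of pipes in reading order

  signal-stamp : ∀ D d → signal (cells D) (stamp d) ≡ isStone (D d)
  signal-stamp D d = trans (time-signal (cells D) (rowUp d) (left<m d)) (cells-box D d)

  right-state : ∀ D d → state (signal (cells D)) (stamp d) (letter (stamp d)) ≡ fromRight sh D d
  right-state D d = trans (hor-state (cells D) (up<k d) (left<m d)) (sym (fromRight≡hor D d))

  below-state : ∀ D d → state (signal (cells D)) (stamp d) (suc (letter (stamp d))) ≡ fromBelow sh D d
  below-state D d = trans (ver-state (cells D) (up<k d) (left<m d)) (sym (fromBelow≡ver D d))

  meet⇒adjacent : ∀ D {x y d} → Meet sh D x y d →
    Adjacent (state (signal (cells D)) (stamp d)) (letter (stamp d)) x y
  meet⇒adjacent D {d = d} (inj₁ (atB , atR)) = inj₂ (trans (right-state D d) atR , trans (below-state D d) atB)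
  meet⇒adjacent D {d = d} (inj₂ (atB , atR)) = inj₁ (trans (right-state D d) atR , trans (below-state D d) atB)

  box⇒crosses : ∀ D {d x y} → Stone (D d) → fromRight sh D d ≡ x → fromBelow sh D d ≡ y →
    Crosses (signal (cells D)) x y (stamp d)
  box⇒crosses D {d} stone atR atB =
    trans (signal-stamp D d) stone , trans (right-state D d) atR , trans (below-state D d) atB

  crosses⇒box : ∀ D {x y t} → t < k * m → Crosses (signal (cells D)) x y t →
    ∃ λ d → stamp d ≡ t × Stone (D d) × fromRight sh D d ≡ x × fromBelow sh D d ≡ y
  crosses⇒box D {t = t} t<km (stone , atR , atB)
    with d , up≡ , left≡ ← stone-box D (row< t<km) (m%n<n t m) stone
    with refl ← trans (cong₂ time up≡ left≡) (time-inverse t) =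
    d , refl , trans (sym (signal-stamp D d)) stone ,
    trans (sym (right-state D d)) atR , trans (sym (below-state D d)) atB

  before⇒stamp< : ∀ {c d} → Before sh c d → stamp c < stamp d
  before⇒stamp< {c} {d} (row≤row , col≤col , strict) = lex⇒time<
    (∸-monoʳ-≤ k (s≤s row≤row)) (∸-monoʳ-≤ m (s≤s col≤col))
    (Sum.map (λ lt → ∸-monoʳ-< (s≤s lt) (rowOf<k c)) (λ lt → ∸-monoʳ-< (s≤s lt) (colOf<m c)) strict)

  Visits : Diagram sh → ℕ → Box sh → Set
  Visits D x d = fromRight sh D d ≡ x ⊎ fromBelow sh D d ≡ x

  visits⇒enters : ∀ D {x} d → Visits D x d → Enters (cells D) x (rowUp d) (colLeft d)
  visits⇒enters D d = Sum.map (trans (sym (fromRight≡hor D d))) (trans (sym (fromBelow≡ver D d)))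

  -- Reading order is finer than `Before`; a pipe common to both boxes, flowing only Northwest,
  -- makes the converse hold.
  stamp<⇒before : ∀ D {x c d} → Visits D x c → Visits D x d → stamp c < stamp d → Before sh c d
  stamp<⇒before D {x} {c} {d} x∈c x∈d lt
    with up≤ , left≤ , strict ← enters-monotone (cells D) (up<k c) (left<m c) (up<k d) (left<m d) (visits⇒enters D c x∈c) (visits⇒enters D d x∈d) lt =
      subst₂ _≤_ (mirror-involutive (rowOf<k d)) (mirror-involutive (rowOf<k c)) (∸-monoʳ-≤ k (s≤s up≤))
    , subst₂ _≤_ (mirror-involutive (colOf<m d)) (mirror-involutive (colOf<m c)) (∸-monoʳ-≤ m (s≤s left≤))
    , Sum.map
        (λ up< → subst₂ _<_ (mirror-involutive (rowOf<k d)) (mirror-involutive (rowOf<k c)) (∸-monoʳ-< (s≤s up<) (up<k d)))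
        (λ left< → subst₂ _<_ (mirror-involutive (colOf<m d)) (mirror-involutive (colOf<m c)) (∸-monoʳ-< (s≤s left<) (left<m d)))
        strict

  -- Corrective flips

  inverted-at : ∀ D b → Inverted (suc (k + m)) (state (signal (cells D)) (stamp b)) (fromBelow sh D b) (fromRight sh D b)
  inverted-at D b = letter (stamp b) , suc (letter (stamp b)) , n<1+n _ , letter< (stamp< b) , right-state D b , below-state D b

  potentialOf : Diagram sh → ℕ
  potentialOf D = potential (suc (k + m)) (k * m) (signal (cells D))

  sameBox-refl : ∀ d → sameBox sh d d ≡ true
  sameBox-refl d = cong₂ _∧_ (≡ᵇ-refl (rowOf sh d)) (≡ᵇ-refl (colOf sh d))

  sameBox-distinct : ∀ {d e} → stamp d ≢ stamp e → sameBox sh d e ≡ false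
  sameBox-distinct {d} {e} d≢e with sameBox sh d e in eq
  ... | false = refl
  ... | true with r≡ , c≡ ← ∧-true eq = ⊥-elim (d≢e
    (cong₂ (λ r c → time (k ∸ suc r) (m ∸ suc c)) (≡ᵇ-sound {rowOf sh d} r≡) (≡ᵇ-sound {colOf sh d} c≡)))

  module _ {D D′ : Diagram sh} {b e : Box sh} (D′≡ : ∀ d → D′ d ≡ recolor sh (exchange sh D b e) d)
    (b-plus : D b ≡ plus) (e-stone : Stone (D e)) where

    private
      τ τ′ : ℕ → Bool
      τ  = signal (cells D)
      τ′ = signal (cells D′)

      τb : τ (stamp b) ≡ false
      τb = trans (signal-stamp D b) (cong isStone b-plus)

      τe : τ (stamp e) ≡ true
      τe = trans (signal-stamp D e) e-stone

    b≢e : stamp b ≢ stamp e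
    b≢e eq with () ← trans (sym τb) (trans (cong τ eq) τe)

    flip-stone : ∀ d → τ′ (stamp d) ≡ isStone (exchange sh D b e d)
    flip-stone d = trans (signal-stamp D′ d) (trans (cong isStone (D′≡ d)) (isStone-recolor (exchange sh D b e) d))

    signal-b : τ′ (stamp b) ≡ not (τ (stamp b))
    signal-b rewrite flip-stone b | sameBox-refl b | τb = refl

    signal-e : τ′ (stamp e) ≡ not (τ (stamp e))
    signal-e rewrite flip-stone e | sameBox-distinct {e} {b} (b≢e ∘ sym) | sameBox-refl e | τe = refl

    signal-elsewhere : ∀ t → t < k * m → t ≢ stamp b → t ≢ stamp e → τ′ t ≡ τ t
    signal-elsewhere t t<km t≢b t≢e with m ∸ suc (t % m) <? rowℕ sh (k ∸ suc (t / m))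
    ... | no outside = trans (cells-nonbox D′ (t / m) (t % m) (≮⇒≥ outside))
                         (sym (cells-nonbox D (t / m) (t % m) (≮⇒≥ outside)))
    ... | yes in′ with d , up≡ , left≡ ← box-at (row< t<km) (m%n<n t m) in′
      with refl ← trans (cong₂ time up≡ left≡) (time-inverse t) =
      trans (flip-stone d) (trans (cong isStone unchanged) (sym (signal-stamp D d)))
      where
      unchanged : exchange sh D b e d ≡ D d
      unchanged rewrite sameBox-distinct {d} {b} t≢b | sameBox-distinct {d} {e} t≢e = refl

  flip-decreases : ∀ {D D′} → Flip sh D D′ → potentialOf D′ < potentialOf D
  flip-decreases {D} {D′} (b , b-plus , (_ , descent) , c , (c-stone , c-meet , c-cross , c<b , c-last) , e , e∈ , D′≡) =
    by-cases e∈
    where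
    x y : ℕ
    x = fromBelow sh D b
    y = fromRight sh D b
    τ : ℕ → Bool
    τ = signal (cells D)
    x<y : x < y
    x<y = descent⇒inverted D b descent

    c-at : Visits D x c
    c-at = Sum.swap (Sum.map proj₁ proj₂ c-meet)

    -- Going backwards from b, the pipes could only become uninverted at a crossing later than c.
    inverted-cb : ∀ t → stamp c < t → t ≤ stamp b → Inverted (suc (k + m)) (state τ t) x y
    inverted-cb t c<t t≤b = inverted-backward letter< τ t≤b (<⇒≤ (stamp< b)) (inverted-at D b) no-crossing
      where
      no-crossing : ∀ s → t ≤ s → s < stamp b → ¬ Crosses τ x y s
      no-crossing s t≤s s<b crossing
        with d , refl , stone , r≡ , b≡ ← crosses⇒box D (<-trans s<b (stamp< b)) crossing =
        c-last d stone (inj₂ (b≡ , r≡)) (subst₂ _<_ (sym r≡) (sym b≡) x<y)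
          (stamp<⇒before D c-at (inj₁ r≡) (<-≤-trans c<t t≤s))
          (stamp<⇒before D (inj₁ r≡) (inj₂ refl) s<b)

    by-cases : e ≡ c ⊎ UncrossingPartner sh D b c e → potentialOf D′ < potentialOf D
    -- Exchange with c: the interval starts right after c and ends at b.
    by-cases (inj₁ refl) = potential-decreases {t₁ = stamp c} {stamp b} (before⇒stamp< c<b) (stamp< b)
      (λ t t<M t≢c t≢b → signal-elsewhere D′≡ b-plus c-stone t t<M t≢b t≢c)
      (signal-e D′≡ b-plus c-stone) (signal-b D′≡ b-plus c-stone)
      (meet⇒adjacent D c-meet) (inj₂ (right-state D b , below-state D b)) x<y inverted-cb
    -- Exchange with the partner: the interval starts after b, and the pipes stay inverted until e,
    -- the first stone after c where they meet.
    by-cases (inj₂ (e-stone , e-meet , c<e , e-first)) = potential-decreases {t₁ = stamp b} {stamp e} b<e (stamp< e)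
      (signal-elsewhere D′≡ b-plus e-stone)
      (signal-b D′≡ b-plus e-stone) (signal-e D′≡ b-plus e-stone)
      (inj₂ (right-state D b , below-state D b)) (meet⇒adjacent D e-meet) x<y
      (λ t b<t t≤e → inverted-forward letter< τ (<⇒≤ b<t) (≤-trans t≤e (<⇒≤ (stamp< e))) (inverted-at D b)
        (no-uncrossing t≤e))
      where
      e-at : Visits D x e
      e-at = Sum.swap (Sum.map proj₁ proj₂ e-meet)

      -- The pipes are inverted all the way from c to b. A stone between at which they meet would
      -- find them sorted if it is a crossing, and leave them sorted if it is an uncrossing.
      not-before : ¬ stamp e < stamp b
      not-before e<b with meet⇒adjacent D e-meet
      ... | inj₁ (r≡ , b≡) = ¬inverted (state-injective τ (stamp e)) r≡ b≡
              (inverted-cb (stamp e) (before⇒stamp< c<e) (<⇒≤ e<b))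
      ... | inj₂ (r≡ , b≡) = ¬inverted (state-injective τ (suc (stamp e)))
              (trans (stone-step (letter (stamp e))) (trans (cong (state τ (stamp e)) (sᵢ-left _)) b≡))
              (trans (stone-step (suc (letter (stamp e)))) (trans (cong (state τ (stamp e)) (sᵢ-right _)) r≡))
              (inverted-cb (suc (stamp e)) (m<n⇒m<1+n (before⇒stamp< c<e)) e<b)
        where
        stone-step : ∀ p → state τ (suc (stamp e)) p ≡ state τ (stamp e) (sᵢ (letter (stamp e)) p)
        stone-step p rewrite signal-stamp D e | e-stone = refl

      b<e : stamp b < stamp e
      b<e with <-cmp (stamp b) (stamp e)
      ... | tri< lt _ _ = lt
      ... | tri≈ _ eq _ = ⊥-elim (b≢e D′≡ b-plus e-stone eq)
      ... | tri> _ _ gt = ⊥-elim (not-before gt)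

      no-uncrossing : ∀ {t} → t ≤ stamp e → ∀ s → stamp b ≤ s → s < t → ¬ Crosses τ y x s
      no-uncrossing t≤e s b≤s s<t crossing
        with d , refl , stone , r≡ , b≡ ← crosses⇒box D (<-trans (<-≤-trans s<t t≤e) (stamp< e)) crossing =
        e-first d stone (inj₁ (b≡ , r≡))
          (stamp<⇒before D c-at (inj₂ b≡) (<-≤-trans (before⇒stamp< c<b) b≤s))
          (stamp<⇒before D (inj₂ b≡) e-at (<-≤-trans s<t t≤e))

  -- A descent means that the entering pipes are inverted, so they have a last crossing, which
  -- itself can be exchanged with b.
  flip-exists : ∀ D b → D b ≡ plus → Descent sh D b → ∃ λ D′ → Flip sh D D′
  flip-exists D b b-plus descent
    with s , s<b , crossing , last ← last-crossing letter< (signal (cells D)) (descent⇒inverted D b descent)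
           (stamp b) (<⇒≤ (stamp< b)) (inverted-at D b)
    with c , refl , stone , r≡ , b≡ ← crosses⇒box D (<-trans s<b (stamp< b)) crossing =
    recolor sh (exchange sh D b c) , b , b-plus , (not-black , descent) , c ,
    (stone , inj₂ (b≡ , r≡) , subst₂ _<_ (sym r≡) (sym b≡) x<y ,
      stamp<⇒before D (inj₁ r≡) (inj₂ refl) s<b , last′) ,
    c , inj₁ refl , λ _ → refl
    where
    x<y : fromBelow sh D b < fromRight sh D b
    x<y = descent⇒inverted D b descent
    not-black : D b ≢ black
    not-black eq with () ← trans (sym b-plus) eq
    last′ : ∀ d → Stone (D d) → Meet sh D (fromBelow sh D b) (fromRight sh D b) d → Crossing sh D d →
      Before sh c d → ¬ Before sh d b
    -- Met this way round, the larger label comes from the right, which is no crossing.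
    last′ d d-stone (inj₁ (b≡′ , r≡′)) d-cross c<d d<b = <-asym x<y (subst₂ _<_ r≡′ b≡′ d-cross)
    last′ d d-stone (inj₂ (b≡′ , r≡′)) d-cross c<d d<b =
      last (stamp d) (before⇒stamp< c<d) (before⇒stamp< d<b) (box⇒crosses D d-stone r≡′ b≡′)

  -- Termination and terminal diagrams

  flip-accessible : ∀ D → Acc (λ E F → Flip sh F E) D
  -- The result of a flip counts as smaller than its source, so accessibility says that every
  -- sequence of flips is finite.
  flip-accessible D = accessible (On.wellFounded potentialOf <-wellFounded D)
    where open Subrelation {_<₁_ = λ E F → Flip sh F E} {_<₂_ = _<_ on potentialOf} flip-decreases

  flips-wellColored : ∀ {D D′} → WellColored sh D → Star (Flip sh) D D′ → WellColored sh D′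
  flips-wellColored coloured ε              = coloured
  flips-wellColored coloured (flip ◅ flips) = flips-wellColored (flip-wellColored flip) flips

  terminal⇒go : ∀ D → WellColored sh D → Terminal sh D → IsGo sh D
  terminal⇒go D coloured terminal b = black⇒descent , descent⇒black
    where
    colour : D b ≡ paint (isStone (D b)) (fromRight sh D b <ᵇ fromBelow sh D b)
    colour = trans (coloured b) (recolor≡paint D b)

    black⇒descent : D b ≡ black → Descent sh D b
    black⇒descent b-black = inverted⇒descent D b
      -- The absence of a crossing gives a weak inequality, strict because the two labels differ.
      (≤∧≢⇒< (≮⇒≥ uncrossed) (fromRight≢fromBelow D b ∘ sym))
      where
      uncrossed : ¬ Crossing sh D b
      uncrossed cross with colour
      ... | eq rewrite b-black | <ᵇ-complete cross with () ← eq

    descent⇒black : Descent sh D b → D b ≡ black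
    descent⇒black descent = by-tile (D b) refl
      where
      by-tile : ∀ t → D b ≡ t → D b ≡ black
      by-tile black eq = eq
      by-tile plus  eq = ⊥-elim (let D′ , flip = flip-exists D b eq descent in terminal D′ flip)
      -- A white stone is coloured as a crossing, while a descent has the larger label coming from
      -- the right.
      by-tile white eq with () ← trans (sym eq) (trans colour
        (cong₂ paint (cong isStone eq) (<ᵇ-refute (<⇒≤ (descent⇒inverted D b descent)))))

mainTheorem4 : (k n : ℕ) → 0 < k → k < n →
    (sh : Shape k (n ∸ k)) → (D : Diagram sh) → WellColored sh D →
    Acc (λ E F → Flip sh F E) D ×
    (∀ D' → Star (Flip sh) D D' → Terminal sh D' → IsGo sh D')
mainTheorem4 k n 0<k k<n sh D coloured = flip-accessible D ,
  λ D' flips terminal → terminal⇒go D' (flips-wellColored coloured flips) terminal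
  where
  instance
    -- k < n provides at least one column, so moments can be divided by the number of columns.
    _ = >-nonZero (m<n⇒0<n∸m k<n)
  open Ferrers sh
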